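{- Let $q$ be a prime power and $\mathcal{C}$ a $q$-divisible set of points of $\mathrm{PG}(v-1,q)$ (for some $v$) with $2\le n=|\mathcal{C}|\le q^2$. Then either $n=q^2$ or $q+1$ divides $n$. Moreover, every such value of $n$ (i.e. $n=q^2$, and every multiple of $q+1$ in $[2,q^2]$) is the cardinality of some $q$-divisible set of points in some projective space over $\mathbb{F}_q$.
   Context: $\mathrm{PG}(v-1,q)$ denotes the set of $1$-dimensional subspaces (points) of $\mathbb{F}_q^v$; hyperplanes are the $(v-1)$-dimensional subspaces of $\mathbb{F}_q^v$. A set $\mathcal{C}$ of points is called $\Delta$-divisible (for an integer $\Delta\ge1$) if there is an integer $u$ with $|\mathcal{C}\cap H|\equiv u\pmod{\Delta}$ for every hyperplane $H$, where $\mathcal{C}\cap H$ is the set of points of $\mathcal{C}$ contained in $H$. -}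

module Defs where

open import Algebra.Bundles using (CommutativeRing)
open import Algebra.Definitions using (Invertible)
open import Algebra.Definitions.RawMonoid using (sum)
open import Data.Fin.Base using (Fin)
open import Data.Integer.Base as ℤ using (ℤ; +_)
import Data.Integer.Divisibility as ℤ
open import Data.Nat.Base using (ℕ; suc; _≥_; _^_)
open import Data.Nat.Primality using (Prime)
open import Data.Product.Base using (Σ-syntax; ∃-syntax; _×_; _,_; proj₁)
open import Data.Vec.Functional using (Vector)
open import Function.Base using (_∘_)
open import Function.Bundles using (Inverse)
open import Level using (Level; _⊔_) renaming (suc to lsuc)
open import Relation.Binary.Bundles using (Setoid)
open import Relation.Binary.Core using (Rel)
open import Relation.Binary.Definitions using (_Respects_)
import Relation.Binary.Construct.On as On
open import Relation.Binary.PropositionalEquality.Core using (_≡_)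
import Relation.Binary.PropositionalEquality.Properties as ≡
open import Relation.Nullary.Negation using (¬_)
open import Relation.Unary using (Pred; _⊆_; _∩_)
open import Relation.Unary.Relation.Binary.Equality using (≐-setoid)

HasCardinality : ∀ {a ℓ} → Setoid a ℓ → ℕ → Set (a ⊔ ℓ)
HasCardinality S n = Inverse (≡.setoid (Fin n)) S

IsPrimePower : ℕ → Set
IsPrimePower q = ∃[ p ] ∃[ k ] (Prime p × k ≥ 1 × q ≡ p ^ k)

_≡_[mod_] : ℤ → ℤ → ℕ → Set
a ≡ b [mod Δ ] = + Δ ℤ.∣ a ℤ.- b

record Field c ℓ : Set (lsuc (c ⊔ ℓ)) where
  field
    commutativeRing : CommutativeRing c ℓ

  open CommutativeRing commutativeRing public

  field
    1≉0        : ¬ (1# ≈ 0#)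
    invertible : ∀ {x} → ¬ (x ≈ 0#) → Invertible _≈_ 1# _*_ x

-- The geometry PG(v-1,q), indexed by the dimension v of the ambient vector
-- space, for F the field with q elements.
module ProjectiveSpace {c ℓ : Level} (F : Field c ℓ) where

  open Field F

  𝔽^_ : ℕ → Set c
  𝔽^ v = Vector Carrier v

  _≋_ : ∀ {v} → Rel (𝔽^ v) ℓ
  x ≋ y = ∀ i → x i ≈ y i

  linearCombination : ∀ {v k} → Vector Carrier k → Vector (𝔽^ v) k → 𝔽^ v
  linearCombination a b j = sum +-rawMonoid (λ i → a i * b i j)

  -- A predicate of level c ⊔ ℓ is general enough: that is where the linear span
  -- of a finite family lives, so a subspace with a finite basis at any other
  -- level has the same elements as one of these.
  record Subspace (v : ℕ) : Set (lsuc (c ⊔ ℓ)) where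
    field
      Member   : Pred (𝔽^ v) (c ⊔ ℓ)
      resp     : Member Respects _≋_
      0-closed : Member (λ _ → 0#)
      +-closed : ∀ {x y} → Member x → Member y → Member (λ i → x i + y i)
      *-closed : ∀ a {x} → Member x → Member (λ i → a * x i)

  open Subspace public using (Member)

  LinearlyIndependent : ∀ {v k} → Vector (𝔽^ v) k → Set (c ⊔ ℓ)
  LinearlyIndependent b =
    ∀ a → linearCombination a b ≋ (λ _ → 0#) → ∀ i → a i ≈ 0#

  record IsBasis {v k} (U : Subspace v) (b : Vector (𝔽^ v) k) : Set (c ⊔ ℓ) where
    field
      members     : ∀ i → Member U (b i)
      independent : LinearlyIndependent b
      spanning    : ∀ {x} → Member U x → ∃[ a ] x ≋ linearCombination a b

  HasDimension : ∀ {v} → Subspace v → ℕ → Set (c ⊔ ℓ)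
  HasDimension {v} U k = Σ[ b ∈ Vector (𝔽^ v) k ] IsBasis U b

  IsHyperplane : ∀ {v} → Subspace v → Set (c ⊔ ℓ)
  IsHyperplane {v} H = ∃[ k ] (suc k ≡ v × HasDimension H k)

  Point : ℕ → Set (lsuc (c ⊔ ℓ))
  Point v = Σ[ U ∈ Subspace v ] HasDimension U 1

  -- Points are equal when they have the same elements; the chosen basis vector
  -- is irrelevant.
  pointSetoid : ℕ → Setoid (lsuc (c ⊔ ℓ)) (c ⊔ ℓ)
  pointSetoid v = On.setoid (≐-setoid (𝔽^ v) (c ⊔ ℓ)) (Member ∘ proj₁ {B = λ U → HasDimension U 1})

  record PointSet (v : ℕ) : Set (lsuc (c ⊔ ℓ)) where
    field
      Contains : Pred (Point v) (c ⊔ ℓ)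
      resp     : Contains Respects Setoid._≈_ (pointSetoid v)

  open PointSet public using (Contains)

  ∣_∣≡_ : ∀ {v} → Pred (Point v) (c ⊔ ℓ) → ℕ → Set (lsuc (c ⊔ ℓ))
  ∣_∣≡_ {v} S n = HasCardinality (On.setoid (pointSetoid v) (proj₁ {B = S})) n

  pointsIn : ∀ {v} → Subspace v → Pred (Point v) (c ⊔ ℓ)
  pointsIn H (P , _) = Member P ⊆ Member H

  IsDivisible : ∀ {v} → ℕ → PointSet v → Set (lsuc (c ⊔ ℓ))
  IsDivisible {v} Δ C =
    ∃[ u ] ∀ (H : Subspace v) → IsHyperplane H →
      ∃[ m ] (∣ Contains C ∩ pointsIn H ∣≡ m × (+ m) ≡ u [mod Δ ])

{-# OPTIONS --safe #-}
module Submission where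

-- Identify hyperplanes with kernels of nonzero functionals f ∈ F^v, let q w(f) be the number of points
-- of C outside ker f, and put N = (q − 1) n. Translating f along a functional that separates two points
-- gives the first two moments q² Σ w = N q^v and q⁴ Σ w² = (N² + N) q^v. Write n = a (q + 1) + j with 0 < j ≤ q
-- and suppose n < q². If a + j < q then w ≤ a, which contradicts the first moment; otherwise the sum of
-- (w − a) (w − a − 1) ≥ 0 contradicts the second. Conversely, q² is realised by an affine plane and
-- m (q + 1) by m pairwise disjoint lines of PG(3,q).

open import Defs
open import Data.Bool.Base using (if_then_else_)
open import Data.Fin.Base
  using (Fin; zero; suc; _↑ˡ_; _↑ʳ_; combine; remQuot; funToFin; finToFun; inject≤; punchIn; punchOut)
open import Data.Fin.Permutation using (↔⇒≡)
import Data.Fin.Properties as Fin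
open import Data.Integer.Base as ℤ using (ℤ)
open import Data.Integer.Divisibility.Signed as ℤ using (∣ᵤ⇒∣; ∣⇒∣ᵤ)
import Data.Integer.Properties as ℤ
import Data.Integer.Tactic.RingSolver as ℤ
open import Data.Nat.Base as ℕ using (ℕ; zero; suc)
open import Data.Nat.Divisibility as ℕ using (divides)
import Data.Nat.Properties as ℕ
open import Data.Nat.Tactic.RingSolver using (solve-∀)
open import Data.Product.Base using (_,_; _×_; Σ; ∃-syntax; proj₁; proj₂; uncurry)
open import Data.Sum.Base using (_⊎_; inj₁; inj₂; [_,_]′)
open import Data.Vec.Functional using (_∷_; [])
open import Data.Vec.Functional.Relation.Binary.Equality.Setoid using (≋-setoid)
open import Function.Base using (_∘_; id)
open import Function.Bundles using (Inverse)
import Function.Construct.Composition as Composition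
import Function.Construct.Symmetry as Symmetry
open import Level using (Lift; lift; lower)
open import Relation.Binary.Bundles using (Setoid)
import Relation.Binary.Construct.On as On
open import Relation.Binary.Definitions as Binary using (_Respects_)
open import Relation.Binary.PropositionalEquality as ≡ using (_≡_)
import Relation.Binary.Reasoning.Setoid as ≈-Reasoning
open import Relation.Nullary using (¬_; Dec; yes; no; does; contradiction)
open import Relation.Nullary.Decidable using (¬?; map′)
open import Relation.Unary using (Pred; Decidable; _∩_)
open import Algebra.Properties.Semiring.Sum ℕ.+-*-semiring
  using ( sum; sum-syntax; sum-cong-≗; sum-replicate-zero; sum-permute
        ; ∑-comm; ∑-distrib-+; *-distribˡ-sum; *-distribʳ-sum)

-- The quadratic step is a variance estimate. Over all functionals w has mean N/q² and second moment
-- (N² + N)/q⁴, hence variance N/q⁴; as w is an integer, (N - a q²)((a + 1) q² - N) ≤ N for every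
-- natural number a. If a + j < q, the mean may exceed a by so little that this says nothing, and
-- only the trivial bound q w ≤ n helps. Sums run over all of F^v rather than over hyperplanes
-- because functionals can be translated; each hyperplane is then counted q - 1 times. The price is
-- the zero functional, whose kernel is not a hyperplane. The hypothesis yields only a common
-- residue of the numbers |C ∩ H|. That q divides the number of points outside H, so that w is an
-- integer at all, is itself a consequence of the first moment. Equality in F is a setoid relation.
-- The enumeration of F makes it decidable, so that a linear relation, a nonzero coordinate or a
-- nonvanishing minor is obtained by finite search.

module Moments where

  -- Inequalities for integer weights with two prescribed moments.

  open import Data.Nat.Base hiding (zero; suc)
  open import Data.Nat.Divisibility using (_∣_)
  open import Data.Nat.DivMod using (m≡m%n+[m/n]*n; m%n<n)
  open import Data.Nat.Properties
  open ≡

  sum-const : ∀ n x → ∑[ i < n ] x ≡ n * x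
  sum-const zero    x = refl
  sum-const (suc n) x = cong (x +_) (sum-const n x)

  sum-mono : ∀ {n} {f g : Fin n → ℕ} → (∀ i → f i ≤ g i) → sum f ≤ sum g
  sum-mono {zero}  f≤g = z≤n
  sum-mono {suc n} f≤g = +-mono-≤ (f≤g zero) (sum-mono (λ i → f≤g (suc i)))

  -- (w − a) (w − a − 1) ≥ 0 for integers w and a.
  consecutive-product : ∀ a w → (2 * a + 1) * w ≤ w * w + a * (a + 1)
  consecutive-product a w with ≤-<-connex w a
  -- Both branches add the value k² + k of the product, where k is a - w here and w - a - 1 below.
  ... | inj₁ w≤a with k , refl ← m≤n⇒∃[o]m+o≡n w≤a =
    subst ((2 * (w + k) + 1) * w ≤_) (expand w k) (m≤m+n _ (k * k + k))
    where
    expand : ∀ w k → (2 * (w + k) + 1) * w + (k * k + k) ≡ w * w + (w + k) * (w + k + 1)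
    expand = solve-∀
  ... | inj₂ a<w with k , refl ← m≤n⇒∃[o]m+o≡n a<w =
    subst ((2 * a + 1) * suc (a + k) ≤_) (expand a k) (m≤m+n _ (k * k + k))
    where
    expand : ∀ a k → (2 * a + 1) * suc (a + k) + (k * k + k) ≡ suc (a + k) * suc (a + k) + a * (a + 1)
    expand = solve-∀

  module _ {M : ℕ} .{{_ : NonZero M}} (r n : ℕ) (w : Fin M → ℕ)
    (first-moment : (suc r * suc r) * sum w ≡ (n * r) * M)
    (second-moment : (suc r * suc r) * (suc r * suc r) * (∑[ k < M ] (w k * w k))
                     ≡ ((n * r) * (n * r) + n * r) * M)
    where

    private
      Q N : ℕ
      Q = suc r * suc r
      N = n * r

    first-moment-bound : ∀ a → (∀ k → w k ≤ a) → N ≤ Q * a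
    first-moment-bound a w≤a = *-cancelʳ-≤ N (Q * a) M (begin
      N * M              ≡⟨ first-moment ⟨
      Q * sum w          ≤⟨ *-monoʳ-≤ Q (sum-mono w≤a) ⟩
      Q * (∑[ k < M ] a) ≡⟨ cong (Q *_) (sum-const M a) ⟩
      Q * (M * a)        ≡⟨ cong (Q *_) (*-comm M a) ⟩
      Q * (a * M)        ≡⟨ *-assoc Q a M ⟨
      Q * a * M          ∎)
      where open ≤-Reasoning

    -- Sum `consecutive-product` over all indices, insert both moments and cancel `M`: what remains
    -- involves only `N`, `Q` and `a`.
    second-moment-bound : ∀ a → (2 * a + 1) * Q * N ≤ N * N + N + a * (a + 1) * (Q * Q)
    second-moment-bound a = *-cancelʳ-≤ _ _ M (begin
      (2 * a + 1) * Q * N * M                                  ≡⟨ *-assoc ((2 * a + 1) * Q) N M ⟩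
      (2 * a + 1) * Q * (N * M)                                ≡⟨ cong ((2 * a + 1) * Q *_) first-moment ⟨
      (2 * a + 1) * Q * (Q * sum w)                            ≡⟨ shuffle (2 * a + 1) Q (sum w) ⟩
      Q * Q * ((2 * a + 1) * sum w)                            ≡⟨ cong (Q * Q *_) (*-distribˡ-sum (2 * a + 1) w) ⟩
      Q * Q * (∑[ k < M ] ((2 * a + 1) * w k))                 ≤⟨ *-monoʳ-≤ (Q * Q) (sum-mono (λ k → consecutive-product a (w k))) ⟩
      Q * Q * (∑[ k < M ] (w k * w k + a * (a + 1)))           ≡⟨ cong (Q * Q *_) (∑-distrib-+ (λ k → w k * w k) (λ _ → a * (a + 1))) ⟩
      Q * Q * ((∑[ k < M ] (w k * w k)) + (∑[ k < M ] (a * (a + 1)))) ≡⟨ cong (λ t → Q * Q * ((∑[ k < M ] (w k * w k)) + t)) (sum-const M (a * (a + 1))) ⟩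
      Q * Q * ((∑[ k < M ] (w k * w k)) + M * (a * (a + 1)))   ≡⟨ *-distribˡ-+ (Q * Q) (∑[ k < M ] (w k * w k)) _ ⟩
      Q * Q * (∑[ k < M ] (w k * w k)) + Q * Q * (M * (a * (a + 1))) ≡⟨ cong (_+ Q * Q * (M * (a * (a + 1)))) second-moment ⟩
      (N * N + N) * M + Q * Q * (M * (a * (a + 1)))            ≡⟨ collect (N * N + N) M (Q * Q) (a * (a + 1)) ⟩
      (N * N + N + a * (a + 1) * (Q * Q)) * M                  ∎)
      where
      open ≤-Reasoning
      shuffle : ∀ x y z → x * y * (y * z) ≡ y * y * (x * z)
      shuffle = solve-∀
      collect : ∀ x m y z → x * m + y * (m * z) ≡ (x + z * y) * m
      collect = solve-∀

  -- With N = a Q + b and Q = b + β the second-moment bound reads (N − a Q) ((a + 1) Q − N) ≤ N.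
  second-moment-violated : ∀ i d s →
    let q = 2 + (i + d + s); r = suc (i + d + s); a = i + d; N = ((i + d + 1) * q + i) * r in
    ¬ ((2 * a + 1) * (q * q) * N ≤ N * N + N + a * (a + 1) * (q * q * (q * q)))
  second-moment-violated i d s bound = <⇒≱ N<bβ bβ≤N
    where
    q = 2 + (i + d + s)
    r = suc (i + d + s)
    a = i + d
    N = ((i + d + 1) * q + i) * r
    -- These are b = N - a Q and β = (a + 1) Q - N for Q = q², written without subtraction. In terms
    -- of n = a (q + 1) + j the parameters are i = a + j - q, d = q - j and s = q - 2 - a.
    b = q + q * s + i * r
    β = suc d * q + i
    -- This is b β - N - 1, arranged as a polynomial without negative terms.
    extra = r * (d + 1 + s) + (i + d + s) + i * i * r + q * s * d * q + i * r * d * q + q * s * (r + i)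

    square : ∀ i d s → let q = 2 + (i + d + s); r = suc (i + d + s) in
             q * q ≡ (q + q * s + i * r) + (suc d * q + i)
    square = solve-∀

    split : ∀ i d s → let q = 2 + (i + d + s); r = suc (i + d + s) in
            ((i + d + 1) * q + i) * r ≡ (i + d) * (q * q) + (q + q * s + i * r)
    split = solve-∀

    gap : ∀ i d s → let q = 2 + (i + d + s); r = suc (i + d + s) in
          (q + q * s + i * r) * (suc d * q + i)
          ≡ suc (((i + d) * (q * q) + (q + q * s + i * r))
                 + (r * (d + 1 + s) + (i + d + s) + i * i * r + q * s * d * q + i * r * d * q + q * s * (r + i)))
    gap = solve-∀

    -- This is (N - a Q)(N - (a + 1) Q) = - b β with the negative terms moved across.
    factor : ∀ a b β → let Q = b + β; N = a * Q + b in
             (2 * a + 1) * Q * N ≡ b * β + (N * N + a * (a + 1) * (Q * Q))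
    factor = solve-∀

    N<bβ : N < b * β
    N<bβ = begin-strict
      N                       ≡⟨ split i d s ⟩
      a * (q * q) + b         ≤⟨ m≤m+n _ extra ⟩
      a * (q * q) + b + extra <⟨ n<1+n _ ⟩
      suc (a * (q * q) + b + extra) ≡⟨ gap i d s ⟨
      b * β                   ∎
      where open ≤-Reasoning

    shuffle : ∀ x y z → x + y + z ≡ y + (x + z)
    shuffle = solve-∀

    bβ≤N : b * β ≤ N
    bβ≤N = +-cancelʳ-≤ (N * N + a * (a + 1) * (q * q * (q * q))) (b * β) N (begin
      b * β + (N * N + a * (a + 1) * (q * q * (q * q))) ≡⟨ cong₂ (λ N Q → b * β + (N * N + a * (a + 1) * (Q * Q))) N≡ (square i d s) ⟩
      b * β + (N′ * N′ + a * (a + 1) * (Q′ * Q′))       ≡⟨ factor a b β ⟨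
      (2 * a + 1) * Q′ * N′                             ≡⟨ cong₂ (λ N Q → (2 * a + 1) * Q * N) N≡ (square i d s) ⟨
      (2 * a + 1) * (q * q) * N                         ≤⟨ bound ⟩
      N * N + N + a * (a + 1) * (q * q * (q * q))       ≡⟨ shuffle (N * N) N _ ⟩
      N + (N * N + a * (a + 1) * (q * q * (q * q)))     ∎)
      where
      open ≤-Reasoning
      Q′ = b + β
      N′ = a * Q′ + b
      N≡ : N ≡ N′
      N≡ = trans (split i d s) (cong (λ Q → a * Q + b) (square i d s))

  -- The difference N - q² k equals 1 + s + j r, so the mean of the weights lies strictly above k.
  first-moment-violated : ∀ k s j →
    let r = suc (k + s); q = suc r; n = suc j + k * suc q in
    ¬ (n * r ≤ q * q * k)
  first-moment-violated k s j = <⇒≱ (subst (q * q * k <_) (sym (expand k s j)) (m<m+n _ z<s))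
    where
    q = 2 + (k + s)
    expand : ∀ k s j → let r = suc (k + s); q = suc r in
             (suc j + k * suc q) * r ≡ q * q * k + suc (s + j * r)
    expand = solve-∀

  moment-dichotomy : ∀ {M r n} .{{_ : NonZero M}} (w : Fin M → ℕ) →
    (suc r * suc r) * sum w ≡ (n * r) * M →
    (suc r * suc r) * (suc r * suc r) * (∑[ k < M ] (w k * w k)) ≡ ((n * r) * (n * r) + n * r) * M →
    (∀ k → suc r * w k ≤ n) →
    n ≤ suc r * suc r →
    n ≡ suc r * suc r ⊎ suc (suc r) ∣ n
  moment-dichotomy {M} {r} {n} w m₁ m₂ qw≤n n≤q² with m≤n⇒m<n∨m≡n n≤q²
  ... | inj₂ n≡q² = inj₁ n≡q²
  ... | inj₁ n<q² = inj₂ (go (n / suc q) (n % suc q) (m≡m%n+[m/n]*n n (suc q)) (m%n<n n (suc q)))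
    where
    q = suc r
    go : ∀ k j → n ≡ j + k * suc q → j < suc q → suc q ∣ n
    go k zero n≡ _ = record { quotient = k ; equality = n≡ }
    go k (suc j) refl (s<s j<q) with ≤-<-connex r k
    -- A quotient of at least q - 1 with a positive remainder means n ≥ (q - 1)(q + 1) + 1 = q².
    ... | inj₁ r≤k = contradiction (≤-trans (≤-reflexive (square r)) (s≤s (≤-trans (*-monoˡ-≤ (suc q) r≤k) (m≤n+m _ j)))) (<⇒≱ n<q²)
      where
      square : ∀ r → suc r * suc r ≡ suc (r * suc (suc r))
      square = solve-∀
    ... | inj₂ k<r with s , refl ← m≤n⇒∃[o]m+o≡n k<r with ≤-<-connex q (k + suc j)
    ...   | inj₂ k+j<q =
      contradiction (first-moment-bound r (suc j + k * suc q) w m₁ m₂ k w≤k) (first-moment-violated k s j)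
      where
      open ≤-Reasoning
      regroup : ∀ k j q → j + k * suc q ≡ k + j + q * k
      regroup = solve-∀
      w≤k : ∀ t → w t ≤ k
      w≤k t = ≤-pred (*-cancelˡ-< q (w t) (suc k) (begin-strict
        q * w t             ≤⟨ qw≤n t ⟩
        suc j + k * suc q   ≡⟨ regroup k (suc j) q ⟩
        k + suc j + q * k   <⟨ +-monoˡ-< (q * k) k+j<q ⟩
        q + q * k           ≡⟨ *-suc q k ⟨
        q * suc k           ∎))
    -- Now n = (k + 1) q + i with i = k + suc j - q, and the remainder bound suc j ≤ q gives i ≤ k,
    -- so k = i + d.
    ...   | inj₁ q≤k+j with i , q+i≡k+j ← m≤n⇒∃[o]m+o≡n q≤k+j
            with d , refl ← m≤n⇒∃[o]m+o≡n (+-cancelˡ-≤ q i k (subst₂ _≤_ (sym q+i≡k+j) (+-comm k q) (+-monoʳ-≤ k j<q))) =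
      contradiction
        (subst (λ n → (2 * (i + d) + 1) * (q * q) * (n * r) ≤ n * r * (n * r) + n * r + (i + d) * (i + d + 1) * (q * q * (q * q)))
          n≡ (second-moment-bound r (suc j + (i + d) * suc q) w m₁ m₂ (i + d)))
        (second-moment-violated i d s)
      where
      regroup₁ : ∀ k j q → j + k * suc q ≡ k * q + (k + j)
      regroup₁ = solve-∀
      regroup₂ : ∀ k i q → k * q + (q + i) ≡ (k + 1) * q + i
      regroup₂ = solve-∀
      n≡ : suc j + (i + d) * suc q ≡ (i + d + 1) * q + i
      n≡ = trans (regroup₁ (i + d) (suc j) q)
             (trans (cong ((i + d) * q +_) (sym q+i≡k+j)) (regroup₂ (i + d) i q))

-- Indicator sums and cardinalities of setoids.

module Counting where
  open import Data.Nat.Base using (_+_; _*_; _^_)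
  open import Data.Nat.Properties using (+-assoc)
  open Moments using (sum-const)
  open ≡

  ⟦_⟧ : ∀ {p} {P : Set p} → Dec P → ℕ
  ⟦ P? ⟧ = if does P? then 1 else 0

  ⟦⟧-cong : ∀ {p r} {P : Set p} {R : Set r} (P? : Dec P) (R? : Dec R) →
            (P → R) → (R → P) → ⟦ P? ⟧ ≡ ⟦ R? ⟧
  ⟦⟧-cong (yes p) (yes r) _ _ = refl
  ⟦⟧-cong (yes p) (no ¬r) f _ = contradiction (f p) ¬r
  ⟦⟧-cong (no ¬p) (yes r) _ g = contradiction (g r) ¬p
  ⟦⟧-cong (no ¬p) (no ¬r) _ _ = refl

  ⟦⟧-true : ∀ {p} {P : Set p} (P? : Dec P) → P → ⟦ P? ⟧ ≡ 1
  ⟦⟧-true (yes _) _ = refl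
  ⟦⟧-true (no ¬p) p = contradiction p ¬p

  ⟦⟧-false : ∀ {p} {P : Set p} (P? : Dec P) → ¬ P → ⟦ P? ⟧ ≡ 0
  ⟦⟧-false (yes p) ¬p = contradiction p ¬p
  ⟦⟧-false (no _) _ = refl

  ⟦⟧-complement : ∀ {p} {P : Set p} (P? : Dec P) → ⟦ P? ⟧ + ⟦ ¬? P? ⟧ ≡ 1
  ⟦⟧-complement (yes _) = refl
  ⟦⟧-complement (no _) = refl

  sum-zero : ∀ {n} {f : Fin n → ℕ} → (∀ i → f i ≡ 0) → sum f ≡ 0
  sum-zero {n} f≡0 = trans (sum-cong-≗ f≡0) (sum-replicate-zero n)

  sum-single : ∀ {n p} {P : Pred (Fin n) p} (P? : Decidable P) {a} →
               P a → (∀ {i} → P i → i ≡ a) → ∑[ i < n ] ⟦ P? i ⟧ ≡ 1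
  sum-single {suc n} P? {zero} pa unique =
    cong₂ _+_ (⟦⟧-true (P? zero) pa) (sum-zero (λ i → ⟦⟧-false (P? (suc i)) (λ p → contradiction (unique p) λ ())))
  sum-single {suc n} P? {suc a} pa unique =
    cong₂ _+_ (⟦⟧-false (P? zero) (λ p → contradiction (unique p) λ ()))
              (sum-single (P? ∘ suc) pa (Fin.suc-injective ∘ unique))

  sum-↑ : ∀ m {n} (f : Fin (m + n) → ℕ) → sum f ≡ ∑[ i < m ] f (i ↑ˡ n) + ∑[ j < n ] f (m ↑ʳ j)
  sum-↑ zero    f = refl
  sum-↑ (suc m) f = trans (cong (f zero +_) (sum-↑ m (f ∘ suc))) (sym (+-assoc (f zero) _ _))

  sum-combine : ∀ m {n} (f : Fin (m * n) → ℕ) → sum f ≡ ∑[ i < m ] ∑[ j < n ] f (combine i j)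
  sum-combine zero    f = refl
  sum-combine (suc m) {n} f = trans (sum-↑ n f) (cong (∑[ j < n ] f (j ↑ˡ (m * n)) +_) (sum-combine m (f ∘ (n ↑ʳ_))))

  cardinality-unique : ∀ {a ℓ} {S : Setoid a ℓ} {m n} → HasCardinality S m → HasCardinality S n → m ≡ n
  cardinality-unique C D = ↔⇒≡ (Composition.inverse C (Symmetry.inverse D))

  -- Conjugating `τ` by the enumeration gives a permutation of `Fin n`, which leaves a finite sum
  -- unchanged.
  sum-bijection : ∀ {a ℓ n} {S : Setoid a ℓ} (C : HasCardinality S n) (τ : Inverse S S)
                  (f : Setoid.Carrier S → ℕ) → (∀ {x y} → Setoid._≈_ S x y → f x ≡ f y) →
                  ∑[ i < n ] f (Inverse.to C i) ≡ ∑[ i < n ] f (Inverse.to τ (Inverse.to C i))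
  sum-bijection {n = n} C τ f f-cong =
    trans (sum-permute {n} {n} (f ∘ Inverse.to C) (Composition.inverse (Composition.inverse C τ) (Symmetry.inverse C)))
          (sum-cong-≗ (λ i → f-cong (Inverse.strictlyInverseˡ C (Inverse.to τ (Inverse.to C i)))))

  private
    -- Induction on n, keeping or dropping index 0. Elements are compared by first component only,
    -- so different proofs of `P` do not multiply them.
    Fin-subset-cardinality : ∀ {n p} {P : Pred (Fin n) p} (P? : Decidable P) →
      HasCardinality (On.setoid (setoid (Fin n)) (proj₁ {B = P})) (∑[ i < n ] ⟦ P? i ⟧)
    Fin-subset-cardinality {zero} P? = record
      { to = λ () ; from = λ () ; to-cong = λ { {()} } ; from-cong = λ { {() , _} }
      ; inverse = (λ { {() , _} }) , (λ { {()} }) }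
    Fin-subset-cardinality {suc n} {P = P} P? with P? zero | Fin-subset-cardinality (P? ∘ suc)
    ... | yes p₀ | E = record
      { to = to ; from = from ; to-cong = λ { refl → refl } ; from-cong = λ {x} {y} → from-cong {x} {y}
      ; inverse = (λ {x} {y} → inverseˡ {x} {y}) , (λ {x} {y} → inverseʳ {x} {y}) }
      where
      to : Fin (suc _) → Σ (Fin (suc n)) P
      to zero    = zero , p₀
      to (suc k) = suc (proj₁ (Inverse.to E k)) , proj₂ (Inverse.to E k)
      from : Σ (Fin (suc n)) P → Fin (suc _)
      from (zero  , p) = zero
      from (suc i , p) = suc (Inverse.from E (i , p))
      from-cong : ∀ {x y} → proj₁ x ≡ proj₁ y → from x ≡ from y
      from-cong {zero , _}  {zero , _}  _ = refl
      from-cong {suc i , _} {suc j , _} e = cong suc (Inverse.from-cong E (Fin.suc-injective e))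
      inverseˡ : ∀ {x y} → y ≡ from x → proj₁ (to y) ≡ proj₁ x
      inverseˡ {zero , _}  refl = refl
      inverseˡ {suc i , p} refl = cong suc (Inverse.inverseˡ E {i , p} refl)
      inverseʳ : ∀ {x y} → proj₁ y ≡ proj₁ (to x) → from y ≡ x
      inverseʳ {zero}  {zero , _} _ = refl
      inverseʳ {suc k} {suc i , p} e = cong suc (Inverse.inverseʳ E {k} {i , p} (Fin.suc-injective e))
    ... | no ¬p₀ | E = record
      { to = to ; from = from ; to-cong = λ { refl → refl } ; from-cong = λ {x} {y} → from-cong {x} {y}
      ; inverse = (λ {x} {y} → inverseˡ {x} {y}) , (λ {x} {y} → inverseʳ {x} {y}) }
      where
      to : Fin _ → Σ (Fin (suc n)) P
      to k = suc (proj₁ (Inverse.to E k)) , proj₂ (Inverse.to E k)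
      from : Σ (Fin (suc n)) P → Fin _
      from (zero  , p) = contradiction p ¬p₀
      from (suc i , p) = Inverse.from E (i , p)
      from-cong : ∀ {x y} → proj₁ x ≡ proj₁ y → from x ≡ from y
      from-cong {zero , p}  {_}  _ = contradiction p ¬p₀
      from-cong {suc i , _} {suc j , _} e = Inverse.from-cong E (Fin.suc-injective e)
      inverseˡ : ∀ {x y} → y ≡ from x → proj₁ (to y) ≡ proj₁ x
      inverseˡ {zero , p}  _ = contradiction p ¬p₀
      inverseˡ {suc i , p} refl = cong suc (Inverse.inverseˡ E {i , p} refl)
      inverseʳ : ∀ {x y} → proj₁ y ≡ proj₁ (to x) → from y ≡ x
      inverseʳ {k} {suc i , p} e = Inverse.inverseʳ E {k} {i , p} (Fin.suc-injective e)

  module _ {a ℓ p r n} (S : Setoid a ℓ) {P : Pred (Setoid.Carrier S) p} {R : Pred (Setoid.Carrier S) r}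
    (C : HasCardinality (On.setoid S (proj₁ {B = P})) n)
    (resp : R Respects Setoid._≈_ S) (R? : Decidable R)
    where

    private
      open Setoid S using () renaming (sym to ≈-sym)
      module C = Inverse C
      E = Fin-subset-cardinality (λ i → R? (proj₁ (C.to i)))
      module E = Inverse E

    -- Turns the size of a hyperplane section into an indicator sum. Passing from x to its index
    -- replaces x by an equivalent enumerated element, which is where `resp` enters.
    ∩-cardinality : HasCardinality (On.setoid S (proj₁ {B = P ∩ R})) (∑[ i < n ] ⟦ R? (proj₁ (C.to i)) ⟧)
    ∩-cardinality = record
      { to = λ k → let i , ri = E.to k ; x , px = C.to i in x , px , ri
      ; from = λ { (x , px , rx) → E.from (index x px rx) }
      ; to-cong = λ { refl → Setoid.refl S }
      ; from-cong = λ { {x , px , rx} {y , py , ry} e → E.from-cong (C.from-cong {x , px} {y , py} e) }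
      ; inverse =
          (λ { {x , px , rx} refl → C.inverseˡ {x , px} (E.inverseˡ {index x px rx} refl) })
        , (λ { {k} {x , px , rx} e → E.inverseʳ {k} {index x px rx} (C.inverseʳ {proj₁ (E.to k)} {x , px} e) })
      }
      where
      index : ∀ x → P x → R x → Σ (Fin n) (λ i → R (proj₁ (C.to i)))
      index x px rx = C.from (x , px) , resp (≈-sym (C.strictlyInverseˡ (x , px))) rx

  private
    funToFin-cong : ∀ {m n} {f g : Fin m → Fin n} → (∀ i → f i ≡ g i) → funToFin f ≡ funToFin g
    funToFin-cong {zero}  f≗g = refl
    funToFin-cong {suc m} f≗g = cong₂ combine (f≗g zero) (funToFin-cong (f≗g ∘ suc))

  vector-cardinality : ∀ {a ℓ q} {S : Setoid a ℓ} → HasCardinality S q → ∀ v → HasCardinality (≋-setoid S v) (q ^ v)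
  vector-cardinality {q = q} {S} C v = record
    { to = λ k → to ∘ finToFun k
    ; from = λ x → funToFin (from ∘ x)
    ; to-cong = λ { refl _ → Setoid.refl S }
    ; from-cong = λ x≋y → funToFin-cong (from-cong ∘ x≋y)
    ; inverse = (λ { {x} refl i → inverseˡ (Fin.finToFun-funToFin (from ∘ x) i) })
              , (λ { {k} x≋k → trans (funToFin-cong (inverseʳ ∘ x≋k)) (Fin.funToFin-finToFin {v} {q} k) })
    }
    where open Inverse C

open Moments
open Counting
open import Data.Integer.Base using (+_)

-- Meant for values `a` that are congruent to e except for a zero at one index, with `b` the
-- indicator of that index: the total is then e (m - 1) modulo d, without splitting the sum.
sum-residues : ∀ {m d} (e : ℤ) (a b : Fin m → ℕ) →
  (∀ i → d ℤ.∣ (+ a i ℤ.+ e ℤ.* + b i) ℤ.- e) →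
  d ℤ.∣ (+ sum a ℤ.+ e ℤ.* + sum b) ℤ.- e ℤ.* + m
sum-residues {zero}  e a b h = ℤ.divides (+ 0) (zeros e)
  where
  zeros : ∀ e → (+ 0 ℤ.+ e ℤ.* + 0) ℤ.- e ℤ.* + 0 ≡ + 0
  zeros = ℤ.solve-∀
sum-residues {suc m} e a b h = ≡.subst (_ ℤ.∣_) (regroup e (+ a zero) (+ b zero) (+ sum (a ∘ suc)) (+ sum (b ∘ suc)) (+ m))
  (ℤ.∣m∣n⇒∣m+n (h zero) (sum-residues e (a ∘ suc) (b ∘ suc) (h ∘ suc)))
  where
  regroup : ∀ e a b A B m → ((a ℤ.+ e ℤ.* b) ℤ.- e) ℤ.+ ((A ℤ.+ e ℤ.* B) ℤ.- e ℤ.* m)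
                          ≡ ((a ℤ.+ A) ℤ.+ e ℤ.* (b ℤ.+ B)) ℤ.- e ℤ.* (+ 1 ℤ.+ m)
  regroup = ℤ.solve-∀

-- Linear algebra over a finite field.

module FiniteField {c ℓ r} (F : Field c ℓ) (card : HasCardinality (Field.setoid F) (suc r)) where

  open Field F hiding (zero)
  open ProjectiveSpace F
  open import Algebra.Properties.Ring ring
    using (-‿distribˡ-*; -1*x≈-x)
  open import Algebra.Properties.AbelianGroup +-abelianGroup
    using () renaming (x∙y⁻¹≈ε⇒x≈y to x-y≈0⇒x≈y; x≈y⇒x∙y⁻¹≈ε to x≈y⇒x-y≈0)
  import Algebra.Properties.Semiring.Sum semiring as F

  private
    q : ℕ
    q = suc r

    module card = Inverse card

    module vectors v = Inverse (vector-cardinality card v)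

  _≈?_ : Binary.Decidable _≈_
  x ≈? y = map′ injective card.from-cong (card.from x Fin.≟ card.from y)
    where
    injective : card.from x ≡ card.from y → x ≈ y
    injective eq = trans (sym (card.strictlyInverseˡ x)) (trans (card.to-cong eq) (card.strictlyInverseˡ y))

  *-cancelˡ-≉0 : ∀ {a x y} → ¬ a ≈ 0# → a * x ≈ a * y → x ≈ y
  *-cancelˡ-≉0 {a} {x} {y} a≉0 ax≈ay = let b , ba≈1 , _ = invertible a≉0 in begin
    x           ≈⟨ *-identityˡ x ⟨
    1# * x      ≈⟨ *-congʳ ba≈1 ⟨
    b * a * x   ≈⟨ *-assoc b a x ⟩
    b * (a * x) ≈⟨ *-congˡ ax≈ay ⟩
    b * (a * y) ≈⟨ *-assoc b a y ⟨
    b * a * y   ≈⟨ *-congʳ ba≈1 ⟩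
    1# * y      ≈⟨ *-identityˡ y ⟩
    y           ∎
    where open ≈-Reasoning setoid

  x*y≈0⇒y≈0 : ∀ {a x} → ¬ a ≈ 0# → a * x ≈ 0# → x ≈ 0#
  x*y≈0⇒y≈0 a≉0 ax≈0 = *-cancelˡ-≉0 a≉0 (trans ax≈0 (sym (zeroʳ _)))

  dot : ∀ {v} → 𝔽^ v → 𝔽^ v → Carrier
  dot f x = F.sum (λ i → f i * x i)

  dot-cong : ∀ {v} {f g x y : 𝔽^ v} → f ≋ g → x ≋ y → dot f x ≈ dot g y
  dot-cong f≋g x≋y = F.sum-cong-≋ (λ i → *-cong (f≋g i) (x≋y i))

  dot-comm : ∀ {v} (f x : 𝔽^ v) → dot f x ≈ dot x f
  dot-comm f x = F.sum-cong-≋ (λ i → *-comm (f i) (x i))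

  dot-+ˡ : ∀ {v} (f g x : 𝔽^ v) → dot (λ i → f i + g i) x ≈ dot f x + dot g x
  dot-+ˡ f g x = trans (F.sum-cong-≋ (λ i → distribʳ (x i) (f i) (g i))) (F.∑-distrib-+ (λ i → f i * x i) (λ i → g i * x i))

  dot-*ˡ : ∀ {v} a (f x : 𝔽^ v) → dot (λ i → a * f i) x ≈ a * dot f x
  dot-*ˡ a f x = trans (F.sum-cong-≋ (λ i → *-assoc a (f i) (x i))) (sym (F.*-distribˡ-sum a (λ i → f i * x i)))

  dot-+ʳ : ∀ {v} (f x y : 𝔽^ v) → dot f (λ i → x i + y i) ≈ dot f x + dot f y
  dot-+ʳ f x y = trans (dot-comm f _) (trans (dot-+ˡ x y f) (+-cong (dot-comm x f) (dot-comm y f)))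

  dot-*ʳ : ∀ {v} a (f x : 𝔽^ v) → dot f (λ i → a * x i) ≈ a * dot f x
  dot-*ʳ a f x = trans (dot-comm f _) (trans (dot-*ˡ a x f) (*-congˡ (dot-comm x f)))

  dot-zeroˡ : ∀ {v} {f : 𝔽^ v} x → f ≋ (λ _ → 0#) → dot f x ≈ 0#
  dot-zeroˡ {v} x f≋0 = trans (F.sum-cong-≋ (λ i → trans (*-congʳ (f≋0 i)) (zeroˡ (x i)))) (F.sum-replicate-zero v)

  dot-zeroʳ : ∀ {v} (f : 𝔽^ v) {x} → x ≋ (λ _ → 0#) → dot f x ≈ 0#
  dot-zeroʳ f {x} x≋0 = trans (dot-comm f x) (dot-zeroˡ f x≋0)

  dot-combination : ∀ {v k} (f : 𝔽^ v) a (b : Fin k → 𝔽^ v) →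
                    dot f (linearCombination a b) ≈ dot a (λ i → dot f (b i))
  dot-combination {v} {k} f a b = begin
    F.sum (λ j → f j * F.sum (λ i → a i * b i j))   ≈⟨ F.sum-cong-≋ (λ j → F.*-distribˡ-sum (f j) (λ i → a i * b i j)) ⟩
    F.sum (λ j → F.sum (λ i → f j * (a i * b i j))) ≈⟨ F.∑-comm (λ j i → f j * (a i * b i j)) ⟩
    F.sum (λ i → F.sum (λ j → f j * (a i * b i j))) ≈⟨ F.sum-cong-≋ (λ i → F.sum-cong-≋ (λ j → swap (f j) (a i) (b i j))) ⟩
    F.sum (λ i → F.sum (λ j → a i * (f j * b i j))) ≈⟨ F.sum-cong-≋ (λ i → F.*-distribˡ-sum (a i) (λ j → f j * b i j)) ⟨
    F.sum (λ i → a i * F.sum (λ j → f j * b i j))   ∎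
    where
    open ≈-Reasoning setoid
    swap : ∀ x y z → x * (y * z) ≈ y * (x * z)
    swap x y z = trans (sym (*-assoc x y z)) (trans (*-congʳ (*-comm x y)) (*-assoc y x z))

  δ : ∀ {v} → Fin v → 𝔽^ v
  δ i j = if does (i Fin.≟ j) then 1# else 0#

  δ-punchIn : ∀ {v} i (j : Fin v) → δ i (punchIn i j) ≡ 0#
  δ-punchIn i j with i Fin.≟ punchIn i j
  ... | yes eq = contradiction (≡.sym eq) (Fin.punchInᵢ≢i i j)
  ... | no _   = ≡.refl

  δ-punchIn-punchIn : ∀ {v} i (j k : Fin v) → δ (punchIn i j) (punchIn i k) ≡ δ j k
  δ-punchIn-punchIn i j k with punchIn i j Fin.≟ punchIn i k | j Fin.≟ k
  ... | yes _  | yes _  = ≡.refl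
  ... | yes eq | no j≢k = contradiction (Fin.punchIn-injective i j k eq) j≢k
  ... | no neq | yes eq = contradiction (≡.cong (punchIn i) eq) neq
  ... | no _   | no _   = ≡.refl

  dot-δ : ∀ {v} (x : 𝔽^ v) i → dot (δ i) x ≈ x i
  dot-δ x zero = trans (+-cong (*-identityˡ (x zero)) (dot-zeroˡ (x ∘ suc) (λ _ → refl))) (+-identityʳ (x zero))
  dot-δ x (suc i) = trans (+-cong (zeroˡ (x zero)) (dot-δ (x ∘ suc) i)) (+-identityˡ (x (suc i)))

  1<cardinality : ∀ {n} → HasCardinality setoid n → 1 ℕ.< n
  1<cardinality {zero}  C with () ← Inverse.from C 0#
  1<cardinality {suc zero} C = contradiction 1≈0 1≉0
    where
    open Inverse C
    single : ∀ (i j : Fin 1) → i ≡ j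
    single zero zero = ≡.refl
    1≈0 : 1# ≈ 0#
    1≈0 = trans (sym (strictlyInverseˡ 1#)) (trans (to-cong (single (from 1#) (from 0#))) (strictlyInverseˡ 0#))
  1<cardinality {suc (suc _)} C = ℕ.s<s ℕ.z<s

  abstract
    -- Counting replaces elimination: q^k coefficient vectors have at most q^v < q^k combinations,
    -- so two combinations agree, and the difference of their coefficients is the relation.
    linearly-dependent : ∀ {v k} → v ℕ.< k → (b : Fin k → 𝔽^ v) →
      ∃[ a ] linearCombination a b ≋ (λ _ → 0#) × ∃[ i ] ¬ a i ≈ 0#
    linearly-dependent {v} {k} v<k b
      with s , t , s<t , eq ← Fin.pigeonhole (ℕ.^-monoʳ-< q (1<cardinality card) v<k) (λ s → vectors.from v (linearCombination (vectors.to k s) b))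
      = let
          x = vectors.to k s
          y = vectors.to k t
          d = λ i → x i - y i
          xb≋yb : linearCombination x b ≋ linearCombination y b
          xb≋yb j = trans (sym (vectors.strictlyInverseˡ v (linearCombination x b) j))
                     (trans (vectors.to-cong v eq j) (vectors.strictlyInverseˡ v (linearCombination y b) j))
          db≋0 : linearCombination d b ≋ (λ _ → 0#)
          db≋0 j = begin
            dot d (λ i → b i j)                                          ≈⟨ dot-+ˡ x (λ i → - y i) (λ i → b i j) ⟩
            dot x (λ i → b i j) + dot (λ i → - y i) (λ i → b i j)         ≈⟨ +-cong (xb≋yb j) (dot-cong (λ i → sym (-1*x≈-x (y i))) (λ _ → refl)) ⟩
            dot y (λ i → b i j) + dot (λ i → - 1# * y i) (λ i → b i j)    ≈⟨ +-congˡ (dot-*ˡ (- 1#) y (λ i → b i j)) ⟩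
            dot y (λ i → b i j) + - 1# * dot y (λ i → b i j)              ≈⟨ +-congˡ (-1*x≈-x _) ⟩
            dot y (λ i → b i j) - dot y (λ i → b i j)                     ≈⟨ -‿inverseʳ _ ⟩
            0#                                                          ∎
          ¬d≋0 : ¬ (∀ i → d i ≈ 0#)
          ¬d≋0 d≋0 = Fin.<⇒≢ s<t (≡.trans (≡.sym (vectors.strictlyInverseʳ k s))
                       (≡.trans (vectors.from-cong k (λ i → x-y≈0⇒x≈y (x i) (y i) (d≋0 i))) (vectors.strictlyInverseʳ k t)))
        in d , db≋0 , Fin.¬∀⟶∃¬ k (λ i → d i ≈ 0#) (λ i → d i ≈? 0#) ¬d≋0
      where open ≈-Reasoning setoid

  combination-closed : ∀ {v k} (U : Subspace v) a (b : Fin k → 𝔽^ v) →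
                       (∀ i → Member U (b i)) → Member U (linearCombination a b)
  combination-closed {k = zero}  U a b b∈U = Subspace.0-closed U
  combination-closed {k = suc k} U a b b∈U =
    Subspace.+-closed U (Subspace.*-closed U (a zero) (b∈U zero)) (combination-closed U (a ∘ suc) (b ∘ suc) (b∈U ∘ suc))

  -- A subspace with a basis of k vectors is finite, so x can be compared with all q^k combinations.
  member? : ∀ {v k} (U : Subspace v) → HasDimension U k → Decidable (Member U)
  member? {v} {k} U (b , isBasis) x =
    map′ sound complete (Fin.any? (λ s → Fin.all? (λ i → x i ≈? linearCombination (vectors.to k s) b i)))
    where
    open IsBasis isBasis
    sound : ∃[ s ] x ≋ linearCombination (vectors.to k s) b → Member U x
    sound (s , x≋) = Subspace.resp U (λ i → sym (x≋ i)) (combination-closed U (vectors.to k s) b members)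
    complete : Member U x → ∃[ s ] x ≋ linearCombination (vectors.to k s) b
    complete x∈U = let a , x≋ = spanning x∈U in
      vectors.from k a , λ i → trans (x≋ i) (dot-cong (λ j → sym (vectors.strictlyInverseˡ k a j)) (λ _ → refl))

  module _ {v} (U : Subspace v) where
    open Subspace U using (resp; +-closed; *-closed)

    *-cancel-member : ∀ {a} {x : 𝔽^ v} → ¬ a ≈ 0# → Member U (λ i → a * x i) → Member U x
    *-cancel-member {a} {x} a≉0 ax∈U = let b , ba≈1 , _ = invertible a≉0 in
      resp (λ i → trans (sym (*-assoc b a (x i))) (trans (*-congʳ ba≈1) (*-identityˡ (x i)))) (*-closed b ax∈U)

    +-cancel-member : ∀ t {x y : 𝔽^ v} → Member U y → Member U (λ i → x i + t * y i) → Member U x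
    +-cancel-member t {x} {y} y∈U x+ty∈U = resp (λ i → cancel (x i) (y i)) (+-closed x+ty∈U (*-closed (- t) y∈U))
      where
      cancel : ∀ x y → (x + t * y) + - t * y ≈ x
      cancel x y = trans (+-assoc x (t * y) _)
        (trans (+-congˡ (trans (+-congˡ (sym (-‿distribˡ-* t y))) (-‿inverseʳ (t * y)))) (+-identityʳ x))

    difference-member : ∀ s t {x y : 𝔽^ v} → Member U (λ i → x i + s * y i) → Member U (λ i → x i + t * y i) →
                        Member U (λ i → (t - s) * y i)
    difference-member s t {x} {y} xs∈U xt∈U =
      +-cancel-member 1# xs∈U (resp (λ i → sym (rearrange (x i) (y i))) xt∈U)
      where
      rearrange : ∀ x y → (t - s) * y + 1# * (x + s * y) ≈ x + t * y
      rearrange x y = begin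
        (t - s) * y + 1# * (x + s * y) ≈⟨ +-congˡ (*-identityˡ _) ⟩
        (t - s) * y + (x + s * y)      ≈⟨ +-comm _ _ ⟩
        (x + s * y) + (t - s) * y      ≈⟨ +-assoc x (s * y) _ ⟩
        x + (s * y + (t - s) * y)      ≈⟨ +-congˡ (distribʳ y s (t - s)) ⟨
        x + (s + (t - s)) * y          ≈⟨ +-congˡ (*-congʳ (trans (+-comm s _) (trans (+-assoc t (- s) s) (trans (+-congˡ (-‿inverseˡ s)) (+-identityʳ t))))) ⟩
        x + t * y                      ∎
        where open ≈-Reasoning setoid

    -- The v - 1 basis vectors of `U` together with x and y are v + 1 vectors of F^v, hence
    -- dependent. Independence of the basis prevents the coefficients of x and y from both being
    -- zero.
    hyperplane-meets-line : IsHyperplane U → ∀ (x y : 𝔽^ v) →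
      ∃[ a ] ∃[ b ] (¬ a ≈ 0# ⊎ ¬ b ≈ 0#) × Member U (λ i → a * x i + b * y i)
    hyperplane-meets-line (k , ≡.refl , w , isBasis) x y = a zero , a (suc zero) , a₀≉0⊎a₁≉0 , x,y∈U
      where
      open IsBasis isBasis
      dependence = linearly-dependent (ℕ.n<1+n (suc k)) (x ∷ y ∷ w)
      a = proj₁ dependence
      ax≋0 = proj₁ (proj₂ dependence)
      a″ = λ i → a (suc (suc i))
      W = linearCombination a″ w
      open ≈-Reasoning setoid

      x,y∈U : Member U (λ i → a zero * x i + a (suc zero) * y i)
      x,y∈U = +-cancel-member 1# (combination-closed U a″ w members)
        (resp (λ i → sym (trans (trans (+-congˡ (*-identityˡ (W i))) (+-assoc _ _ (W i))) (ax≋0 i))) (Subspace.0-closed U))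

      a₀≉0⊎a₁≉0 : ¬ a zero ≈ 0# ⊎ ¬ a (suc zero) ≈ 0#
      a₀≉0⊎a₁≉0 with a zero ≈? 0# | a (suc zero) ≈? 0#
      ... | no a₀≉0  | _        = inj₁ a₀≉0
      ... | yes _    | no a₁≉0  = inj₂ a₁≉0
      ... | yes a₀≈0 | yes a₁≈0 = contradiction (a≈0 (proj₁ (proj₂ (proj₂ dependence)))) (proj₂ (proj₂ (proj₂ dependence)))
        where
        a≈0 : ∀ i → a i ≈ 0#
        a″≈0 : ∀ i → a″ i ≈ 0#
        a″≈0 = independent a″ (λ i → begin
          W i                                              ≈⟨ +-identityˡ (W i) ⟨
          0# + W i                                         ≈⟨ +-congʳ (zeroˡ (y i)) ⟨
          0# * y i + W i                                   ≈⟨ +-identityˡ _ ⟨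
          0# + (0# * y i + W i)                            ≈⟨ +-congʳ (zeroˡ (x i)) ⟨
          0# * x i + (0# * y i + W i)                      ≈⟨ +-cong (*-congʳ a₀≈0) (+-congʳ (*-congʳ a₁≈0)) ⟨
          a zero * x i + (a (suc zero) * y i + W i)        ≈⟨ ax≋0 i ⟩
          0#                                              ∎)
        a≈0 zero          = a₀≈0
        a≈0 (suc zero)    = a₁≈0
        a≈0 (suc (suc i)) = a″≈0 i

    -- Of the q + 1 points of the line through x and y, a hyperplane contains 1 or q + 1;
    -- this also holds in the degenerate case of dependent x and y.
    line-count : IsHyperplane U → (U? : Decidable (Member U)) → ∀ (x y : 𝔽^ v) →
      ∃[ e ] ∑[ t < q ] ⟦ U? (λ i → x i + card.to t * y i) ⟧ ℕ.+ ⟦ U? y ⟧ ≡ 1 ℕ.+ q ℕ.* e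
    line-count hyperplane U? x y with U? y
    -- Modulo y all the vectors x + t y agree, so the q of them lie in `U` together or not at all.
    ... | yes y∈U = ⟦ U? x ⟧ , ≡.trans (≡.cong (ℕ._+ 1) (≡.trans (sum-cong-≗ same) (sum-const q ⟦ U? x ⟧))) (ℕ.+-comm _ 1)
      where
      same : ∀ t → ⟦ U? (λ i → x i + card.to t * y i) ⟧ ≡ ⟦ U? x ⟧
      same t = ⟦⟧-cong (U? _) (U? x) (+-cancel-member (card.to t) y∈U) (λ x∈U → +-closed x∈U (*-closed (card.to t) y∈U))
    ... | no y∉U with a , b , nonzero , ax+by∈U ← hyperplane-meets-line hyperplane x y =
      0 , ≡.trans (ℕ.+-identityʳ _) (≡.trans (sum-single (λ t → U? (λ i → x i + card.to t * y i)) {card.from t₀} hit unique)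
                                         (≡.cong suc (≡.sym (ℕ.*-zeroʳ q))))
      where
      -- If a were 0, then b y with b nonzero, and hence y, would lie in `U`.
      a≉0 : ¬ a ≈ 0#
      a≉0 = [ id , (λ b≉0 a≈0 → y∉U (*-cancel-member b≉0
        (resp (λ i → trans (+-congʳ (trans (*-congʳ a≈0) (zeroˡ (x i)))) (+-identityˡ _)) ax+by∈U))) ]′ nonzero
      a⁻¹ = proj₁ (invertible a≉0)
      t₀ = a⁻¹ * b
      x+t₀y∈U : Member U (λ i → x i + t₀ * y i)
      x+t₀y∈U = resp (λ i → trans (distribˡ a⁻¹ _ _)
        (+-cong (trans (sym (*-assoc a⁻¹ a (x i))) (trans (*-congʳ (proj₁ (proj₂ (invertible a≉0)))) (*-identityˡ (x i))))
                (sym (*-assoc a⁻¹ b (y i))))) (*-closed a⁻¹ ax+by∈U)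
      hit : Member U (λ i → x i + card.to (card.from t₀) * y i)
      hit = resp (λ i → +-congˡ (*-congʳ (sym (card.strictlyInverseˡ t₀)))) x+t₀y∈U
      unique : ∀ {t} → Member U (λ i → x i + card.to t * y i) → t ≡ card.from t₀
      unique {t} xt∈U with (card.to t - t₀) ≈? 0#
      ... | yes t-t₀≈0 = ≡.trans (≡.sym (card.strictlyInverseʳ t)) (card.from-cong (x-y≈0⇒x≈y (card.to t) t₀ t-t₀≈0))
      -- A second member x + t y would put the nonzero multiple (t - t₀) y of y into `U`.
      ... | no t-t₀≉0  = contradiction (*-cancel-member t-t₀≉0 (difference-member t₀ (card.to t) x+t₀y∈U xt∈U)) y∉U

  -- Hyperplanes as kernels of functionals.

  kernel : ∀ {v} → 𝔽^ v → Subspace v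
  kernel f = record
    { Member   = λ x → Lift c (dot f x ≈ 0#)
    ; resp     = λ x≋y fx≈0 → lift (trans (dot-cong (λ _ → refl) (λ i → sym (x≋y i))) (lower fx≈0))
    ; 0-closed = lift (dot-zeroʳ f (λ _ → refl))
    ; +-closed = λ {x} {y} fx≈0 fy≈0 →
        lift (trans (dot-+ʳ f x y) (trans (+-cong (lower fx≈0) (lower fy≈0)) (+-identityˡ 0#)))
    ; *-closed = λ a {x} fx≈0 → lift (trans (dot-*ʳ a f x) (trans (*-congˡ (lower fx≈0)) (zeroʳ a)))
    }

  -- With pivot i, the vectors e_l - (f_l / f_i) e_i for l ≠ i form a basis; `punchIn i` enumerates
  -- these l. Off the pivot they are the identity matrix, so coefficients are read off as
  -- coordinates.
  kernel-isHyperplane : ∀ {v} (f : 𝔽^ v) {i} → ¬ f i ≈ 0# → IsHyperplane (kernel f)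
  kernel-isHyperplane {suc k} f {i} fi≉0 = k , ≡.refl , w , record
    { members     = λ j → lift (w∈kernel j)
    ; independent = λ a aw≋0 j → trans (sym (combination-off-pivot a j)) (aw≋0 (punchIn i j))
    ; spanning    = λ {x} fx≈0 → (λ j → x (punchIn i j)) , x≋combination x (lower fx≈0)
    }
    where
    open ≈-Reasoning setoid
    fi⁻¹ : Carrier
    fi⁻¹ = proj₁ (invertible fi≉0)

    κ : Fin k → Carrier
    κ j = - (fi⁻¹ * f (punchIn i j))

    w : Fin k → 𝔽^ (suc k)
    w j l = δ (punchIn i j) l + κ j * δ i l

    dot-δʳ : ∀ j → dot f (δ j) ≈ f j
    dot-δʳ j = trans (dot-comm f (δ j)) (dot-δ f j)

    w∈kernel : ∀ j → dot f (w j) ≈ 0#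
    w∈kernel j = begin
      dot f (w j)                                                ≈⟨ dot-+ʳ f (δ (punchIn i j)) (λ l → κ j * δ i l) ⟩
      dot f (δ (punchIn i j)) + dot f (λ l → κ j * δ i l)        ≈⟨ +-cong (dot-δʳ (punchIn i j)) (trans (dot-*ʳ (κ j) f (δ i)) (*-congˡ (dot-δʳ i))) ⟩
      f (punchIn i j) + κ j * f i                                ≈⟨ +-congˡ (-‿distribˡ-* _ (f i)) ⟨
      f (punchIn i j) - fi⁻¹ * f (punchIn i j) * f i             ≈⟨ +-congˡ (-‿cong cancel) ⟩
      f (punchIn i j) - f (punchIn i j)                          ≈⟨ -‿inverseʳ _ ⟩
      0#                                                         ∎
      where
      cancel : fi⁻¹ * f (punchIn i j) * f i ≈ f (punchIn i j)
      cancel = trans (*-comm _ (f i)) (trans (sym (*-assoc (f i) fi⁻¹ _))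
                 (trans (*-congʳ (proj₂ (proj₂ (invertible fi≉0)))) (*-identityˡ _)))

    combination-off-pivot : ∀ a j → linearCombination a w (punchIn i j) ≈ a j
    combination-off-pivot a j = trans (dot-cong (λ _ → refl) w≈δ) (trans (dot-comm a (δ j)) (dot-δ a j))
      where
      symmetric : ∀ l → δ l j ≡ δ j l
      symmetric l with l Fin.≟ j | j Fin.≟ l
      ... | yes _   | yes _   = ≡.refl
      ... | yes eq  | no neq  = contradiction (≡.sym eq) neq
      ... | no neq  | yes eq  = contradiction (≡.sym eq) neq
      ... | no _    | no _    = ≡.refl
      w≈δ : ∀ l → w l (punchIn i j) ≈ δ j l
      w≈δ l = trans (+-cong (reflexive (≡.trans (δ-punchIn-punchIn i l j) (symmetric l)))
                            (trans (*-congˡ (reflexive (δ-punchIn i j))) (zeroʳ (κ l))))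
                    (+-identityʳ _)

    -- The difference d of the two sides lies in the kernel and vanishes off the pivot, so dot f d
    -- reduces to f_i d_i and forces d_i = 0.
    x≋combination : ∀ x → dot f x ≈ 0# → x ≋ linearCombination (λ j → x (punchIn i j)) w
    x≋combination x fx≈0 l = x-y≈0⇒x≈y (x l) (y l) (d≋0 l)
      where
      a = λ j → x (punchIn i j)
      y = linearCombination a w
      d : 𝔽^ (suc k)
      d l = x l - y l
      off-pivot : ∀ j → d (punchIn i j) ≈ 0#
      off-pivot j = x≈y⇒x-y≈0 (sym (combination-off-pivot a j))
      fd≈0 : dot f d ≈ 0#
      fd≈0 = begin
        dot f d                               ≈⟨ dot-+ʳ f x (λ l → - y l) ⟩
        dot f x + dot f (λ l → - y l)         ≈⟨ +-cong fx≈0 (dot-cong {f = f} (λ _ → refl) (λ l → sym (-1*x≈-x (y l)))) ⟩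
        0# + dot f (λ l → - 1# * y l)         ≈⟨ +-identityˡ _ ⟩
        dot f (λ l → - 1# * y l)              ≈⟨ dot-*ʳ (- 1#) f y ⟩
        - 1# * dot f y                        ≈⟨ *-congˡ (trans (dot-combination f a w) (dot-zeroʳ a w∈kernel)) ⟩
        - 1# * 0#                             ≈⟨ zeroʳ _ ⟩
        0#                                    ∎
      at-pivot : d i ≈ 0#
      at-pivot = x*y≈0⇒y≈0 fi≉0 (begin
        f i * d i                                                       ≈⟨ +-identityʳ _ ⟨
        f i * d i + 0#                                                  ≈⟨ +-congˡ (dot-zeroʳ (λ j → f (punchIn i j)) off-pivot) ⟨
        f i * d i + dot (λ j → f (punchIn i j)) (λ j → d (punchIn i j)) ≈⟨ F.sum-remove {i = i} (λ l → f l * d l) ⟨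
        dot f d                                                         ≈⟨ fd≈0 ⟩
        0#                                                              ∎)
      d≋0 : ∀ l → d l ≈ 0#
      d≋0 l = cases (i Fin.≟ l)
        where
        cases : Dec (i ≡ l) → d l ≈ 0#
        cases (yes ≡.refl) = at-pivot
        cases (no i≢l)     = trans (reflexive (≡.cong d (≡.sym (Fin.punchIn-punchOut i≢l)))) (off-pivot (punchOut i≢l))

  -- Distribution of the values of functionals at one and at two vectors.

  nonzero : ∀ {v} → 𝔽^ v → 𝔽^ v → ℕ
  nonzero f x = ⟦ ¬? (dot f x ≈? 0#) ⟧

  nonzero-cong : ∀ {v} {f g : 𝔽^ v} x → dot f x ≈ dot g x → nonzero f x ≡ nonzero g x
  nonzero-cong {f = f} {g} x fx≈gx = ⟦⟧-cong (¬? (dot f x ≈? 0#)) (¬? (dot g x ≈? 0#))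
    (λ fx≉0 gx≈0 → fx≉0 (trans fx≈gx gx≈0)) (λ gx≉0 fx≈0 → gx≉0 (trans (sym fx≈gx) fx≈0))

  translation : ∀ {v} → 𝔽^ v → Inverse (≋-setoid setoid v) (≋-setoid setoid v)
  translation g = record
    { to        = λ f i → f i + g i
    ; from      = λ f i → f i - g i
    ; to-cong   = λ f≋f′ i → +-congʳ (f≋f′ i)
    ; from-cong = λ f≋f′ i → +-congʳ (f≋f′ i)
    ; inverse   = (λ f≋h i → trans (+-congʳ (f≋h i)) (cancel (-‿inverseˡ (g i))))
                , (λ f≋h i → trans (+-congʳ (f≋h i)) (cancel (-‿inverseʳ (g i))))
    }
    where
    cancel : ∀ {x y z} → y + z ≈ 0# → x + y + z ≈ x
    cancel {x} {y} {z} y+z≈0 = trans (+-assoc x y z) (trans (+-congˡ y+z≈0) (+-identityʳ x))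

  shifts-nonzero : ∀ s → ∑[ t < q ] ⟦ ¬? ((s + card.to t) ≈? 0#) ⟧ ≡ r
  shifts-nonzero s = ℕ.+-cancelˡ-≡ 1 _ r (begin
    1 ℕ.+ ∑[ t < q ] ⟦ ¬? (vanishes? t) ⟧                         ≡⟨ ≡.cong (ℕ._+ ∑[ t < q ] ⟦ ¬? (vanishes? t) ⟧) once ⟨
    ∑[ t < q ] ⟦ vanishes? t ⟧ ℕ.+ ∑[ t < q ] ⟦ ¬? (vanishes? t) ⟧ ≡⟨ ∑-distrib-+ (λ t → ⟦ vanishes? t ⟧) (λ t → ⟦ ¬? (vanishes? t) ⟧) ⟨
    ∑[ t < q ] (⟦ vanishes? t ⟧ ℕ.+ ⟦ ¬? (vanishes? t) ⟧)         ≡⟨ sum-cong-≗ (λ t → ⟦⟧-complement (vanishes? t)) ⟩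
    ∑[ t < q ] 1                                                 ≡⟨ sum-const q 1 ⟩
    q ℕ.* 1                                                      ≡⟨ ℕ.*-identityʳ q ⟩
    q                                                            ∎)
    where
    open ≡.≡-Reasoning
    vanishes? : Decidable (λ t → s + card.to t ≈ 0#)
    vanishes? t = (s + card.to t) ≈? 0#
    unique : ∀ {t} → s + card.to t ≈ 0# → t ≡ card.from (- s)
    unique {t} s+t≈0 = ≡.trans (≡.sym (card.strictlyInverseʳ t))
      (card.from-cong (inverseʳ-unique s (card.to t) s+t≈0))
      where open import Algebra.Properties.AbelianGroup +-abelianGroup using (inverseʳ-unique)
    once : ∑[ t < q ] ⟦ vanishes? t ⟧ ≡ 1
    once = sum-single vanishes? {card.from (- s)} (trans (+-congˡ (card.strictlyInverseˡ (- s))) (-‿inverseʳ s)) unique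

  module _ {v : ℕ} where
    private
      functional : Fin (q ℕ.^ v) → 𝔽^ v
      functional = vectors.to v

    -- Along each line f + F g the value at x runs through F exactly once, so it is nonzero r = q − 1 times.
    nonzero-equidistributed : ∀ (φ : 𝔽^ v → ℕ) → (∀ {f h} → f ≋ h → φ f ≡ φ h) →
      ∀ g x → (∀ f t → φ (λ i → f i + t * g i) ≡ φ f) → dot g x ≈ 1# →
      q ℕ.* (∑[ s < q ℕ.^ v ] (φ (functional s) ℕ.* nonzero (functional s) x))
      ≡ r ℕ.* (∑[ s < q ℕ.^ v ] φ (functional s))
    nonzero-equidistributed φ φ-cong g x φ-invariant gx≈1 = begin
      q ℕ.* (∑[ s < _ ] ψ (functional s))                               ≡⟨ sum-const q _ ⟨
      -- Each of the q copies of the sum is reindexed by its own translation, f to f + t g.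
      ∑[ t < q ] ∑[ s < _ ] ψ (functional s)                           ≡⟨ sum-cong-≗ (λ t → sum-bijection (vector-cardinality card v) (translation (λ i → card.to t * g i)) ψ ψ-cong) ⟩
      ∑[ t < q ] ∑[ s < _ ] ψ (λ i → functional s i + card.to t * g i) ≡⟨ ∑-comm (λ t s → ψ (λ i → functional s i + card.to t * g i)) ⟩
      ∑[ s < _ ] ∑[ t < q ] ψ (λ i → functional s i + card.to t * g i) ≡⟨ sum-cong-≗ (λ s → along-line (functional s)) ⟩
      ∑[ s < _ ] (r ℕ.* φ (functional s))                              ≡⟨ *-distribˡ-sum r (λ s → φ (functional s)) ⟨
      r ℕ.* (∑[ s < _ ] φ (functional s))                               ∎
      where
      open ≡.≡-Reasoning
      ψ : 𝔽^ v → ℕ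
      ψ f = φ f ℕ.* nonzero f x
      ψ-cong : ∀ {f h} → f ≋ h → ψ f ≡ ψ h
      ψ-cong f≋h = ≡.cong₂ ℕ._*_ (φ-cong f≋h) (nonzero-cong x (dot-cong f≋h (λ _ → refl)))
      shifted : ∀ f t → dot (λ i → f i + t * g i) x ≈ dot f x + t
      shifted f t = trans (dot-+ˡ f (λ i → t * g i) x) (+-congˡ (trans (dot-*ˡ t g x) (trans (*-congˡ gx≈1) (*-identityʳ t))))
      along-line : ∀ f → ∑[ t < q ] ψ (λ i → f i + card.to t * g i) ≡ r ℕ.* φ f
      along-line f = begin
        ∑[ t < q ] ψ (λ i → f i + card.to t * g i)                    ≡⟨ sum-cong-≗ (λ t → ≡.cong₂ ℕ._*_ (φ-invariant f (card.to t)) (shifted-nonzero t)) ⟩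
        ∑[ t < q ] (φ f ℕ.* ⟦ ¬? ((dot f x + card.to t) ≈? 0#) ⟧)     ≡⟨ *-distribˡ-sum (φ f) (λ t → ⟦ ¬? ((dot f x + card.to t) ≈? 0#) ⟧) ⟨
        φ f ℕ.* (∑[ t < q ] ⟦ ¬? ((dot f x + card.to t) ≈? 0#) ⟧)      ≡⟨ ≡.cong (φ f ℕ.*_) (shifts-nonzero (dot f x)) ⟩
        φ f ℕ.* r                                                    ≡⟨ ℕ.*-comm (φ f) r ⟩
        r ℕ.* φ f                                                    ∎
        where
        shifted-nonzero : ∀ t → nonzero (λ i → f i + card.to t * g i) x ≡ ⟦ ¬? ((dot f x + card.to t) ≈? 0#) ⟧
        shifted-nonzero t = ⟦⟧-cong (¬? (dot (λ i → f i + card.to t * g i) x ≈? 0#)) (¬? ((dot f x + card.to t) ≈? 0#))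
          (λ ≉0 ≈0 → ≉0 (trans (shifted f (card.to t)) ≈0)) (λ ≉0 ≈0 → ≉0 (trans (sym (shifted f (card.to t))) ≈0))

    nonzero-count : ∀ (x : 𝔽^ v) {i} → ¬ x i ≈ 0# →
      q ℕ.* (∑[ s < q ℕ.^ v ] nonzero (functional s) x) ≡ r ℕ.* q ℕ.^ v
    nonzero-count x {i} xi≉0 = begin
      q ℕ.* (∑[ s < _ ] nonzero (functional s) x)           ≡⟨ ≡.cong (q ℕ.*_) (sum-cong-≗ (λ s → ℕ.*-identityˡ (nonzero (functional s) x))) ⟨
      q ℕ.* (∑[ s < _ ] (1 ℕ.* nonzero (functional s) x))   ≡⟨ nonzero-equidistributed (λ _ → 1) (λ _ → ≡.refl) g x (λ _ _ → ≡.refl) gx≈1 ⟩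
      r ℕ.* (∑[ s < q ℕ.^ v ] 1)                           ≡⟨ ≡.cong (r ℕ.*_) (≡.trans (sum-const (q ℕ.^ v) 1) (ℕ.*-identityʳ _)) ⟩
      r ℕ.* q ℕ.^ v                                        ∎
      where
      open ≡.≡-Reasoning
      -- The i-th coordinate functional, scaled to take the value 1 at x.
      g : 𝔽^ v
      g l = proj₁ (invertible xi≉0) * δ i l
      gx≈1 : dot g x ≈ 1#
      gx≈1 = trans (dot-*ˡ _ (δ i) x) (trans (*-congˡ (dot-δ x i)) (proj₁ (proj₂ (invertible xi≉0))))

    -- The 2 × 2 minor of the rows x and y in columns i and j, written with the coefficient - x_j so
    -- that it reads as a linear functional of y.
    minor : 𝔽^ v → 𝔽^ v → Fin v → Fin v → Carrier
    minor x y i j = x i * y j + - x j * y i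

    -- The functional h sending z to `minor x z i j` vanishes at x but not at y. Translating by
    -- multiples of g = h / h(y) fixes the value at x and runs through all values at y, so the two
    -- conditions are independent, each of density r/q.
    nonzero-pair-count : ∀ (x y : 𝔽^ v) {i j k} → ¬ minor x y i j ≈ 0# → ¬ x k ≈ 0# →
      (q ℕ.* q) ℕ.* (∑[ s < q ℕ.^ v ] (nonzero (functional s) x ℕ.* nonzero (functional s) y)) ≡ (r ℕ.* r) ℕ.* q ℕ.^ v
    nonzero-pair-count x y {i} {j} det≉0 xk≉0 = begin
      (q ℕ.* q) ℕ.* (∑[ s < _ ] (nonzero (functional s) x ℕ.* nonzero (functional s) y))  ≡⟨ ℕ.*-assoc q q _ ⟩
      q ℕ.* (q ℕ.* (∑[ s < _ ] (nonzero (functional s) x ℕ.* nonzero (functional s) y)))  ≡⟨ ≡.cong (q ℕ.*_) pair ⟩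
      q ℕ.* (r ℕ.* (∑[ s < _ ] nonzero (functional s) x))                                ≡⟨ swap q r _ ⟩
      r ℕ.* (q ℕ.* (∑[ s < _ ] nonzero (functional s) x))                                ≡⟨ ≡.cong (r ℕ.*_) (nonzero-count x xk≉0) ⟩
      r ℕ.* (r ℕ.* q ℕ.^ v)                                                             ≡⟨ ℕ.*-assoc r r _ ⟨
      (r ℕ.* r) ℕ.* q ℕ.^ v                                                             ∎
      where
      open ≡.≡-Reasoning
      swap : ∀ a b m → a ℕ.* (b ℕ.* m) ≡ b ℕ.* (a ℕ.* m)
      swap = solve-∀
      det⁻¹ = proj₁ (invertible det≉0)
      h g : 𝔽^ v
      h l = x i * δ j l + - x j * δ i l
      g l = det⁻¹ * h l
      dot-h : ∀ z → dot h z ≈ minor x z i j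
      dot-h z = trans (dot-+ˡ (λ l → x i * δ j l) (λ l → - x j * δ i l) z)
        (+-cong (trans (dot-*ˡ (x i) (δ j) z) (*-congˡ (dot-δ z j))) (trans (dot-*ˡ (- x j) (δ i) z) (*-congˡ (dot-δ z i))))
      gx≈0 : dot g x ≈ 0#
      gx≈0 = trans (dot-*ˡ det⁻¹ h x) (trans (*-congˡ (trans (dot-h x) cancel)) (zeroʳ det⁻¹))
        where
        cancel : minor x x i j ≈ 0#
        cancel = trans (+-cong (*-comm (x i) (x j)) (sym (-‿distribˡ-* (x j) (x i)))) (-‿inverseʳ _)
      gy≈1 : dot g y ≈ 1#
      gy≈1 = trans (dot-*ˡ det⁻¹ h y) (trans (*-congˡ (dot-h y)) (proj₁ (proj₂ (invertible det≉0))))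
      pair = nonzero-equidistributed (λ f → nonzero f x) (λ f≋h → nonzero-cong x (dot-cong f≋h (λ _ → refl))) g y
        (λ f t → nonzero-cong x (trans (dot-+ˡ f (λ l → t * g l) x)
          (trans (+-congˡ (trans (dot-*ˡ t g x) (trans (*-congˡ gx≈0) (zeroʳ t)))) (+-identityʳ _)))) gy≈1

  -- Projective points and their representative vectors.

  representative : ∀ {v} → Point v → 𝔽^ v
  representative (_ , b , _) = b zero

  representative-member : ∀ {v} (P : Point v) → Member (proj₁ P) (representative P)
  representative-member (_ , _ , isBasis) = IsBasis.members isBasis zero

  representative-spans : ∀ {v} (P : Point v) {x} → Member (proj₁ P) x →
                         ∃[ a ] x ≋ (λ i → a * representative P i)
  representative-spans (_ , b , isBasis) x∈P = let a , x≋ = IsBasis.spanning isBasis x∈P in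
    a zero , λ i → trans (x≋ i) (+-identityʳ _)

  representative-nonzero : ∀ {v} (P : Point v) → ∃[ i ] ¬ representative P i ≈ 0#
  representative-nonzero {v} (_ , b , isBasis) = Fin.¬∀⟶∃¬ v _ (λ i → b zero i ≈? 0#) λ b≋0 →
    1≉0 (IsBasis.independent isBasis (λ _ → 1#) (λ i → trans (+-identityʳ _) (trans (*-identityˡ _) (b≋0 i))) zero)

  pointsIn⇔member : ∀ {v} (H : Subspace v) (P : Point v) →
    (pointsIn H P → Member H (representative P)) × (Member H (representative P) → pointsIn H P)
  pointsIn⇔member H P = (λ P⊆H → P⊆H (representative-member P)) , λ p∈H x∈P →
    let a , x≋ = representative-spans P x∈P in
    Subspace.resp H (λ i → sym (x≋ i)) (Subspace.*-closed H a p∈H)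

  pointsIn? : ∀ {v} (H : Subspace v) → Decidable (Member H) → Decidable (pointsIn H)
  pointsIn? H H? P = let to , from = pointsIn⇔member H P in map′ from to (H? (representative P))

  pointsIn-resp : ∀ {v} (H : Subspace v) → pointsIn H Respects Setoid._≈_ (pointSetoid v)
  pointsIn-resp H (_ , P′⊆P) P⊆H x∈P′ = P⊆H (P′⊆P x∈P′)

  -- Choose i with x_i nonzero; the vanishing minors say x_i y = y_i x, so y is a multiple of x.
  minors-vanish⇒⊆ : ∀ {v} (P P′ : Point v) →
    (∀ i j → minor (representative P) (representative P′) i j ≈ 0#) → pointsIn (proj₁ P) P′
  minors-vanish⇒⊆ P P′ minors≈0 = proj₂ (pointsIn⇔member (proj₁ P) P′)
    (*-cancel-member (proj₁ P) xi≉0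
      (Subspace.resp (proj₁ P) (λ j → trans (*-comm (y i) (x j)) (sym (proportional j)))
        (Subspace.*-closed (proj₁ P) (y i) (representative-member P))))
    where
    x = representative P
    y = representative P′
    i = proj₁ (representative-nonzero P)
    xi≉0 = proj₂ (representative-nonzero P)
    proportional : ∀ j → x i * y j ≈ x j * y i
    proportional j = x-y≈0⇒x≈y _ _ (trans (+-congˡ (-‿distribˡ-* (x j) (y i))) (minors≈0 i j))

  minor-swap : ∀ {v} (x y : 𝔽^ v) i j → minor x y i j ≈ 0# → minor y x i j ≈ 0#
  minor-swap x y i j xy≈0 = begin
    y i * x j + - y j * x i   ≈⟨ +-cong (*-comm (y i) (x j)) (trans (sym (-‿distribˡ-* (y j) (x i))) (-‿cong (*-comm (y j) (x i)))) ⟩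
    x j * y i - x i * y j     ≈⟨ x≈y⇒x-y≈0 (sym (x-y≈0⇒x≈y _ _ (trans (+-congˡ (-‿distribˡ-* (x j) (y i))) xy≈0))) ⟩
    0#                        ∎
    where open ≈-Reasoning setoid

  distinct-points : ∀ {v} (P P′ : Point v) → ¬ Setoid._≈_ (pointSetoid v) P P′ →
    ∃[ i ] ∃[ j ] ¬ minor (representative P) (representative P′) i j ≈ 0#
  distinct-points {v} P P′ P≉P′ =
    let i , ¬all = Fin.¬∀⟶∃¬ v _ (λ i → Fin.all? (vanishes? i)) (λ minors≈0 →
          P≉P′ ( minors-vanish⇒⊆ P′ P (λ i j → minor-swap (representative P) (representative P′) i j (minors≈0 i j))
               , minors-vanish⇒⊆ P P′ minors≈0))
    in i , Fin.¬∀⟶∃¬ v _ (vanishes? i) ¬all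
    where
    vanishes? : ∀ i → Decidable (λ j → minor (representative P) (representative P′) i j ≈ 0#)
    vanishes? i j = minor (representative P) (representative P′) i j ≈? 0#

  minor-diagonal : ∀ {v} (x y : 𝔽^ v) i → minor x y i i ≈ 0#
  minor-diagonal x y i = trans (+-congˡ (sym (-‿distribˡ-* (x i) (y i)))) (-‿inverseʳ _)

  -- Moments and divisibility of the weights.

  module Weights {v} (C : PointSet v) {n} (C-card : ∣ Contains C ∣≡ n) where

    private
      functional : Fin (q ℕ.^ v) → 𝔽^ v
      functional = vectors.to v

      module C-card = Inverse C-card

    point : Fin n → Point v
    point i = proj₁ (C-card.to i)

    p : Fin n → 𝔽^ v
    p i = representative (point i)

    weight : 𝔽^ v → ℕ
    weight f = ∑[ i < n ] nonzero f (p i)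

    nonzero-diagonal : ∀ i → q ℕ.* (∑[ s < q ℕ.^ v ] nonzero (functional s) (p i)) ≡ r ℕ.* q ℕ.^ v
    nonzero-diagonal i = nonzero-count (p i) (proj₂ (representative-nonzero (point i)))

    distinct : ∀ {i j} → ¬ i ≡ j → ∃[ k ] ∃[ l ] ¬ minor (p i) (p j) k l ≈ 0#
    distinct {i} {j} i≢j = distinct-points (point i) (point j) λ Pi≈Pj →
      i≢j (≡.trans (≡.sym (C-card.strictlyInverseʳ i))
        (≡.trans (C-card.from-cong {C-card.to i} {C-card.to j} Pi≈Pj) (C-card.strictlyInverseʳ j)))

    first-moment : q ℕ.* (∑[ s < q ℕ.^ v ] weight (functional s)) ≡ n ℕ.* (r ℕ.* q ℕ.^ v)
    first-moment = begin
      q ℕ.* (∑[ s < _ ] ∑[ i < n ] nonzero (functional s) (p i))   ≡⟨ ≡.cong (q ℕ.*_) (∑-comm (λ s i → nonzero (functional s) (p i))) ⟩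
      q ℕ.* (∑[ i < n ] ∑[ s < _ ] nonzero (functional s) (p i))   ≡⟨ *-distribˡ-sum q (λ i → ∑[ s < _ ] nonzero (functional s) (p i)) ⟩
      ∑[ i < n ] (q ℕ.* (∑[ s < _ ] nonzero (functional s) (p i))) ≡⟨ sum-cong-≗ nonzero-diagonal ⟩
      ∑[ i < n ] (r ℕ.* q ℕ.^ v)                                  ≡⟨ sum-const n _ ⟩
      n ℕ.* (r ℕ.* q ℕ.^ v)                                       ∎
      where open ≡.≡-Reasoning

    -- On the diagonal the product of indicators is a single indicator and the value is q r q^v =
    -- (r² + r) q^v. The Kronecker term records the excess r q^v over the value for distinct points.
    nonzero-pair : ∀ i j → (q ℕ.* q) ℕ.* (∑[ s < q ℕ.^ v ] (nonzero (functional s) (p i) ℕ.* nonzero (functional s) (p j)))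
                           ≡ r ℕ.* r ℕ.* q ℕ.^ v ℕ.+ (r ℕ.* q ℕ.^ v) ℕ.* ⟦ i Fin.≟ j ⟧
    nonzero-pair i j with i Fin.≟ j
    ... | yes ≡.refl = begin
      (q ℕ.* q) ℕ.* (∑[ s < _ ] (nonzero (functional s) (p i) ℕ.* nonzero (functional s) (p i))) ≡⟨ ≡.cong ((q ℕ.* q) ℕ.*_) (sum-cong-≗ (λ s → idempotent (¬? (dot (functional s) (p i) ≈? 0#)))) ⟩
      (q ℕ.* q) ℕ.* (∑[ s < _ ] nonzero (functional s) (p i))    ≡⟨ ℕ.*-assoc q q _ ⟩
      q ℕ.* (q ℕ.* (∑[ s < _ ] nonzero (functional s) (p i)))    ≡⟨ ≡.cong (q ℕ.*_) (nonzero-diagonal i) ⟩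
      q ℕ.* (r ℕ.* q ℕ.^ v)                                     ≡⟨ expand r (q ℕ.^ v) ⟩
      r ℕ.* r ℕ.* q ℕ.^ v ℕ.+ (r ℕ.* q ℕ.^ v) ℕ.* 1              ∎
      where
      open ≡.≡-Reasoning
      idempotent : ∀ {a} {A : Set a} (A? : Dec A) → ⟦ A? ⟧ ℕ.* ⟦ A? ⟧ ≡ ⟦ A? ⟧
      idempotent (yes _) = ≡.refl
      idempotent (no _)  = ≡.refl
      expand : ∀ r m → suc r ℕ.* (r ℕ.* m) ≡ r ℕ.* r ℕ.* m ℕ.+ (r ℕ.* m) ℕ.* 1
      expand = solve-∀
    ... | no i≢j = let _ , _ , minor≉0 = distinct i≢j in
      ≡.trans (nonzero-pair-count (p i) (p j) minor≉0 (proj₂ (representative-nonzero (point i))))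
              (≡.sym (≡.trans (≡.cong (r ℕ.* r ℕ.* q ℕ.^ v ℕ.+_) (ℕ.*-zeroʳ (r ℕ.* q ℕ.^ v))) (ℕ.+-identityʳ _)))

    second-moment : (q ℕ.* q) ℕ.* (∑[ s < q ℕ.^ v ] (weight (functional s) ℕ.* weight (functional s)))
                    ≡ ((n ℕ.* r) ℕ.* (n ℕ.* r) ℕ.+ n ℕ.* r) ℕ.* q ℕ.^ v
    second-moment = begin
      (q ℕ.* q) ℕ.* (∑[ s < _ ] (weight (functional s) ℕ.* weight (functional s)))
        ≡⟨ ≡.cong ((q ℕ.* q) ℕ.*_) (sum-cong-≗ (λ s → square (functional s))) ⟩
      (q ℕ.* q) ℕ.* (∑[ s < _ ] ∑[ i < n ] ∑[ j < n ] χ s i j)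
        ≡⟨ ≡.cong ((q ℕ.* q) ℕ.*_) (∑-comm (λ s i → ∑[ j < n ] χ s i j)) ⟩
      (q ℕ.* q) ℕ.* (∑[ i < n ] ∑[ s < _ ] ∑[ j < n ] χ s i j)
        ≡⟨ ≡.cong ((q ℕ.* q) ℕ.*_) (sum-cong-≗ (λ i → ∑-comm (λ s j → χ s i j))) ⟩
      (q ℕ.* q) ℕ.* (∑[ i < n ] ∑[ j < n ] ∑[ s < _ ] χ s i j)
        ≡⟨ *-distribˡ-sum (q ℕ.* q) (λ i → ∑[ j < n ] ∑[ s < _ ] χ s i j) ⟩
      ∑[ i < n ] ((q ℕ.* q) ℕ.* (∑[ j < n ] ∑[ s < _ ] χ s i j))
        ≡⟨ sum-cong-≗ (λ i → ≡.trans (*-distribˡ-sum (q ℕ.* q) (λ j → ∑[ s < _ ] χ s i j)) (sum-cong-≗ (nonzero-pair i))) ⟩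
      ∑[ i < n ] ∑[ j < n ] (r ℕ.* r ℕ.* M ℕ.+ (r ℕ.* M) ℕ.* ⟦ i Fin.≟ j ⟧)
        ≡⟨ sum-cong-≗ row ⟩
      ∑[ i < n ] (n ℕ.* (r ℕ.* r ℕ.* M) ℕ.+ (r ℕ.* M) ℕ.* 1)
        ≡⟨ sum-const n _ ⟩
      n ℕ.* (n ℕ.* (r ℕ.* r ℕ.* M) ℕ.+ (r ℕ.* M) ℕ.* 1)
        ≡⟨ collect n r M ⟩
      ((n ℕ.* r) ℕ.* (n ℕ.* r) ℕ.+ n ℕ.* r) ℕ.* M ∎
      where
      open ≡.≡-Reasoning
      M = q ℕ.^ v
      χ : Fin M → Fin n → Fin n → ℕ
      χ s i j = nonzero (functional s) (p i) ℕ.* nonzero (functional s) (p j)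
      square : ∀ f → weight f ℕ.* weight f ≡ ∑[ i < n ] ∑[ j < n ] (nonzero f (p i) ℕ.* nonzero f (p j))
      square f = ≡.trans (*-distribʳ-sum (weight f) (λ i → nonzero f (p i)))
        (sum-cong-≗ (λ i → *-distribˡ-sum (nonzero f (p i)) (λ j → nonzero f (p j))))
      row : ∀ i → ∑[ j < n ] (r ℕ.* r ℕ.* M ℕ.+ (r ℕ.* M) ℕ.* ⟦ i Fin.≟ j ⟧) ≡ n ℕ.* (r ℕ.* r ℕ.* M) ℕ.+ (r ℕ.* M) ℕ.* 1
      row i = ≡.trans (∑-distrib-+ (λ _ → r ℕ.* r ℕ.* M) (λ j → (r ℕ.* M) ℕ.* ⟦ i Fin.≟ j ⟧))
        (≡.cong₂ ℕ._+_ (sum-const n _)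
          (≡.trans (≡.sym (*-distribˡ-sum (r ℕ.* M) (λ j → ⟦ i Fin.≟ j ⟧)))
                   (≡.cong ((r ℕ.* M) ℕ.*_) (sum-single (i Fin.≟_) ≡.refl ≡.sym))))
      collect : ∀ n r M → n ℕ.* (n ℕ.* (r ℕ.* r ℕ.* M) ℕ.+ (r ℕ.* M) ℕ.* 1) ≡ ((n ℕ.* r) ℕ.* (n ℕ.* r) ℕ.+ n ℕ.* r) ℕ.* M
      collect = solve-∀

    -- Divisibility supplies m with an arbitrary enumeration, so m is first identified with the
    -- indicator sum complementary to the weight.
    kernel-count : ∀ f {m} → ∣ Contains C ∩ pointsIn (kernel f) ∣≡ m → m ℕ.+ weight f ≡ n
    kernel-count f {m} m-card = begin
      m ℕ.+ weight f                                            ≡⟨ ≡.cong (ℕ._+ weight f) (cardinality-unique m-card in-kernel-card) ⟩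
      ∑[ i < n ] ⟦ in-kernel? (point i) ⟧ ℕ.+ weight f          ≡⟨ ∑-distrib-+ (λ i → ⟦ in-kernel? (point i) ⟧) (λ i → nonzero f (p i)) ⟨
      ∑[ i < n ] (⟦ in-kernel? (point i) ⟧ ℕ.+ nonzero f (p i)) ≡⟨ sum-cong-≗ (λ i → ⟦⟧-complement (dot f (p i) ≈? 0#)) ⟩
      ∑[ i < n ] 1                                             ≡⟨ sum-const n 1 ⟩
      n ℕ.* 1                                                  ≡⟨ ℕ.*-identityʳ n ⟩
      n                                                        ∎
      where
      open ≡.≡-Reasoning
      in-kernel? : Decidable (pointsIn (kernel f))
      in-kernel? = pointsIn? (kernel f) (λ x → map′ lift lower (dot f x ≈? 0#))
      in-kernel-card = ∩-cardinality (pointSetoid v) C-card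
        (λ {P} {P′} → pointsIn-resp (kernel f) {P} {P′}) in-kernel?

  -- Two distinct points have a nonzero minor, and its two columns must differ. The bound leaves a
  -- factor q in the total weight after the q of the first moment is cancelled.
  dimension≥2 : ∀ {v} (C : PointSet v) {n} → ∣ Contains C ∣≡ n → 2 ℕ.≤ n → 2 ℕ.≤ v
  dimension≥2 C {suc (suc n)} C-card (ℕ.s≤s (ℕ.s≤s ℕ.z≤n)) =
    let i , j , minor≉0 = distinct {zero} {suc zero} (λ ()) in minor-nonzero⇒2≤v (p zero) (p (suc zero)) i j minor≉0
    where
    open Weights C C-card
    minor-nonzero⇒2≤v : ∀ {v} (x y : 𝔽^ v) i j → ¬ minor x y i j ≈ 0# → 2 ℕ.≤ v
    minor-nonzero⇒2≤v {suc zero}    x y zero zero minor≉0 = contradiction (minor-diagonal x y zero) minor≉0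
    minor-nonzero⇒2≤v {suc (suc _)} x y _    _    _       = ℕ.s≤s (ℕ.s≤s ℕ.z≤n)

  -- The weights of nonzero functionals share a residue e modulo q, and weight 0 belongs to the zero functional.
  -- Since v ≥ 2, q divides both the number of functionals and the sum of all weights, so q divides −e.
  weight-divisible : ∀ {v} (C : PointSet v) → IsDivisible q C → ∀ {n} (C-card : ∣ Contains C ∣≡ n) → 2 ℕ.≤ n →
                     ∀ f → q ℕ.∣ Weights.weight C C-card f
  weight-divisible {v} C (u , divisible) {n} C-card 2≤n with dimension≥2 C C-card 2≤n
  weight-divisible {suc (suc v)} C (u , divisible) {n} C-card 2≤n | ℕ.s≤s (ℕ.s≤s ℕ.z≤n) = all-divisible
    where
    open Weights C C-card
    M = q ℕ.^ suc (suc v)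
    functional = vectors.to (suc (suc v))
    Q = + q

    -- By `kernel-count` a nonzero functional has weight n - m with m congruent to u, so its weight
    -- is congruent to e.
    e : ℤ
    e = + n ℤ.- u

    zero? : ∀ f → Dec (∀ i → f i ≈ 0#)
    zero? f = Fin.all? (λ i → f i ≈? 0#)

    weight-zero : ∀ {f} → (∀ i → f i ≈ 0#) → weight f ≡ 0
    weight-zero {f} f≋0 = sum-zero (λ i → ⟦⟧-false (¬? (dot f (p i) ≈? 0#)) (λ fp≉0 → fp≉0 (dot-zeroˡ (p i) f≋0)))

    -- The indicator term compensates for the weight 0 of the zero functional, so that one
    -- congruence serves every f.
    residue : ∀ f → Q ℤ.∣ (+ weight f ℤ.+ e ℤ.* + ⟦ zero? f ⟧) ℤ.- e
    residue f = residue′ (zero? f)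
      where
      vanish : ∀ e → (+ 0 ℤ.+ e ℤ.* + 1) ℤ.- e ≡ + 0
      vanish = ℤ.solve-∀
      negate : ∀ m u w → ℤ.- (m ℤ.- u) ≡ (w ℤ.+ ((m ℤ.+ w) ℤ.- u) ℤ.* + 0) ℤ.- ((m ℤ.+ w) ℤ.- u)
      negate = ℤ.solve-∀
      residue′ : (f≋0? : Dec (∀ i → f i ≈ 0#)) → Q ℤ.∣ (+ weight f ℤ.+ e ℤ.* + ⟦ f≋0? ⟧) ℤ.- e
      residue′ (yes f≋0) = ≡.subst (λ k → Q ℤ.∣ (+ k ℤ.+ e ℤ.* + 1) ℤ.- e) (≡.sym (weight-zero f≋0)) (ℤ.divides (+ 0) (vanish e))
      residue′ (no f≄0) = let
          i , fi≉0 = Fin.¬∀⟶∃¬ _ _ (λ i → f i ≈? 0#) f≄0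
          m , m-card , m≡u = divisible (kernel f) (kernel-isHyperplane f fi≉0)
        in ≡.subst (Q ℤ.∣_)
             (≡.trans (negate (+ m) u (+ weight f))
               (≡.cong (λ n → (+ weight f ℤ.+ (+ n ℤ.- u) ℤ.* + 0) ℤ.- (+ n ℤ.- u)) (kernel-count f m-card)))
             (ℤ.∣m⇒∣-m (∣ᵤ⇒∣ {Q} {+ m ℤ.- u} m≡u))

    zero-functional-once : ∑[ s < M ] ⟦ zero? (functional s) ⟧ ≡ 1
    zero-functional-once = sum-single (λ s → zero? (functional s)) {vectors.from (suc (suc v)) (λ _ → 0#)}
      (vectors.strictlyInverseˡ (suc (suc v)) (λ _ → 0#))
      (λ {s} f≋0 → ≡.trans (≡.sym (vectors.strictlyInverseʳ (suc (suc v)) s)) (vectors.from-cong (suc (suc v)) f≋0))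

    total : ∑[ s < M ] weight (functional s) ≡ n ℕ.* r ℕ.* q ℕ.^ v ℕ.* q
    total = ℕ.*-cancelˡ-≡ _ _ q (≡.trans first-moment (regroup n r (q ℕ.^ v) q))
      where
      regroup : ∀ n r m q → n ℕ.* (r ℕ.* (q ℕ.* (q ℕ.* m))) ≡ q ℕ.* (n ℕ.* r ℕ.* m ℕ.* q)
      regroup = solve-∀

    Q∣e : Q ℤ.∣ e
    Q∣e = ≡.subst (Q ℤ.∣_) (isolate (+ W) e (+ M)) (ℤ.∣m∣n⇒∣m+n (ℤ.∣m∣n⇒∣m-n
            (≡.subst (λ z → Q ℤ.∣ (+ W ℤ.+ e ℤ.* + z) ℤ.- e ℤ.* + M) zero-functional-once
              (sum-residues e (λ s → weight (functional s)) (λ s → ⟦ zero? (functional s) ⟧) (λ s → residue (functional s))))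
            (∣ᵤ⇒∣ {Q} {+ W} (divides (n ℕ.* r ℕ.* q ℕ.^ v) total)))
            (ℤ.∣n⇒∣m*n e (∣ᵤ⇒∣ {Q} {+ M} (divides (q ℕ.^ suc v) (ℕ.*-comm q _)))))
      where
      W = ∑[ s < M ] weight (functional s)
      isolate : ∀ W e M → ((W ℤ.+ e ℤ.* + 1) ℤ.- e ℤ.* M) ℤ.- W ℤ.+ e ℤ.* M ≡ e
      isolate = ℤ.solve-∀

    all-divisible : ∀ f → q ℕ.∣ weight f
    all-divisible f = ∣⇒∣ᵤ {Q} {+ weight f} (≡.subst (Q ℤ.∣_) (isolate (+ weight f) e (+ ⟦ zero? f ⟧))
      (ℤ.∣m∣n⇒∣m-n (ℤ.∣m∣n⇒∣m+n (residue f) Q∣e) (ℤ.∣m⇒∣m*n (+ ⟦ zero? f ⟧) Q∣e)))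
      where
      isolate : ∀ w e z → ((w ℤ.+ e ℤ.* z) ℤ.- e ℤ.+ e) ℤ.- e ℤ.* z ≡ w
      isolate = ℤ.solve-∀

  divisible⇒cardinality : ∀ (v : ℕ) (C : PointSet v) → IsDivisible q C →
    ∀ (n : ℕ) → ∣ Contains C ∣≡ n → 2 ℕ.≤ n → n ℕ.≤ q ℕ.^ 2 →
    n ≡ q ℕ.^ 2 ⊎ (q ℕ.+ 1) ℕ.∣ n
  divisible⇒cardinality v C divisible n C-card 2≤n n≤q² =
    ≡.subst₂ (λ Q q+1 → n ≡ Q ⊎ q+1 ℕ.∣ n) (≡.sym q²≡q*q) (ℕ.+-comm 1 q)
      (moment-dichotomy {{ℕ.m^n≢0 q v}} w w-first w-second qw≤n (≡.subst (n ℕ.≤_) q²≡q*q n≤q²))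
    where
    open Weights C C-card
    q²≡q*q : q ℕ.^ 2 ≡ q ℕ.* q
    q²≡q*q = ≡.cong (q ℕ.*_) (ℕ.*-identityʳ q)
    M = q ℕ.^ v
    wt : Fin M → ℕ
    wt s = weight (vectors.to v s)
    q∣wt : ∀ s → q ℕ.∣ wt s
    q∣wt s = weight-divisible C divisible C-card 2≤n (vectors.to v s)
    -- Dividing the weights by q turns the factors q and q² of the two moments into q² and q⁴.
    w : Fin M → ℕ
    w s = ℕ.quotient (q∣wt s)
    qw≡wt : ∀ s → q ℕ.* w s ≡ wt s
    qw≡wt s = ≡.trans (ℕ.*-comm q (w s)) (≡.sym (ℕ._∣_.equality (q∣wt s)))
    qw≤n : ∀ s → q ℕ.* w s ℕ.≤ n
    qw≤n s = ≡.subst₂ ℕ._≤_ (≡.sym (qw≡wt s)) (≡.trans (sum-const n 1) (ℕ.*-identityʳ n))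
      (sum-mono (λ i → ⟦⟧≤1 (¬? (dot (vectors.to v s) (p i) ≈? 0#))))
      where
      ⟦⟧≤1 : ∀ {a} {A : Set a} (A? : Dec A) → ⟦ A? ⟧ ℕ.≤ 1
      ⟦⟧≤1 (yes _) = ℕ.≤-refl
      ⟦⟧≤1 (no _)  = ℕ.z≤n
    w-first : (q ℕ.* q) ℕ.* sum w ≡ (n ℕ.* r) ℕ.* M
    w-first = begin
      (q ℕ.* q) ℕ.* sum w                ≡⟨ ℕ.*-assoc q q (sum w) ⟩
      q ℕ.* (q ℕ.* sum w)                ≡⟨ ≡.cong (q ℕ.*_) (≡.trans (*-distribˡ-sum q w) (sum-cong-≗ qw≡wt)) ⟩
      q ℕ.* sum wt                       ≡⟨ first-moment ⟩
      n ℕ.* (r ℕ.* M)                    ≡⟨ ℕ.*-assoc n r M ⟨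
      (n ℕ.* r) ℕ.* M                    ∎
      where open ≡.≡-Reasoning
    w-second : (q ℕ.* q) ℕ.* (q ℕ.* q) ℕ.* (∑[ s < M ] (w s ℕ.* w s)) ≡ ((n ℕ.* r) ℕ.* (n ℕ.* r) ℕ.+ n ℕ.* r) ℕ.* M
    w-second = begin
      (q ℕ.* q) ℕ.* (q ℕ.* q) ℕ.* (∑[ s < M ] (w s ℕ.* w s))   ≡⟨ ℕ.*-assoc (q ℕ.* q) (q ℕ.* q) _ ⟩
      (q ℕ.* q) ℕ.* ((q ℕ.* q) ℕ.* (∑[ s < M ] (w s ℕ.* w s))) ≡⟨ ≡.cong ((q ℕ.* q) ℕ.*_) (*-distribˡ-sum (q ℕ.* q) (λ s → w s ℕ.* w s)) ⟩
      (q ℕ.* q) ℕ.* (∑[ s < M ] ((q ℕ.* q) ℕ.* (w s ℕ.* w s))) ≡⟨ ≡.cong ((q ℕ.* q) ℕ.*_) (sum-cong-≗ (λ s → ≡.trans (interchange q (w s)) (≡.cong₂ ℕ._*_ (qw≡wt s) (qw≡wt s)))) ⟩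
      (q ℕ.* q) ℕ.* (∑[ s < M ] (wt s ℕ.* wt s))               ≡⟨ second-moment ⟩
      ((n ℕ.* r) ℕ.* (n ℕ.* r) ℕ.+ n ℕ.* r) ℕ.* M              ∎
      where
      open ≡.≡-Reasoning
      interchange : ∀ q w → (q ℕ.* q) ℕ.* (w ℕ.* w) ≡ (q ℕ.* w) ℕ.* (q ℕ.* w)
      interchange = solve-∀

  -- Construction of divisible sets from arrays of vectors.

  span : ∀ {v} → 𝔽^ v → Subspace v
  span x = record
    { Member   = λ y → ∃[ a ] y ≋ (λ i → a * x i)
    ; resp     = λ { y≋z (a , y≋) → a , λ i → trans (sym (y≋z i)) (y≋ i) }
    ; 0-closed = 0# , λ i → sym (zeroˡ (x i))
    ; +-closed = λ { (a , y≋) (b , z≋) → a + b , λ i → trans (+-cong (y≋ i) (z≋ i)) (sym (distribʳ (x i) a b)) }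
    ; *-closed = λ { b (a , y≋) → b * a , λ i → trans (*-congˡ (y≋ i)) (sym (*-assoc b a (x i))) }
    }

  spanPoint : ∀ {v} (x : 𝔽^ v) {i} → ¬ x i ≈ 0# → Point v
  spanPoint x {i} xi≉0 = span x , (λ _ → x) , record
    { members     = λ _ → 1# , λ j → sym (*-identityˡ (x j))
    ; independent = λ { a ax≋0 zero → x*y≈0⇒y≈0 xi≉0 (trans (*-comm (x i) (a zero)) (trans (sym (+-identityʳ _)) (ax≋0 i))) }
    ; spanning    = λ { (a , y≋) → (λ _ → a) , λ j → trans (y≋ j) (sym (+-identityʳ _)) }
    }

  -- The vectors form an array so that hyperplane sections can be counted row by row, along lines.
  -- Since no two of them are proportional, they span a b distinct points.
  module Family {v a b} (w : Fin a → Fin b → 𝔽^ v)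
    (w-nonzero : ∀ i j → ∃[ l ] ¬ w i j l ≈ 0#)
    (w-distinct : ∀ i j i′ j′ t → w i′ j′ ≋ (λ l → t * w i j l) → i ≡ i′ × j ≡ j′)
    where

    private
      z : Fin (a ℕ.* b) → 𝔽^ v
      z k = uncurry w (remQuot b k)

      z-nonzero : ∀ k → ∃[ l ] ¬ z k l ≈ 0#
      z-nonzero k = uncurry w-nonzero (remQuot {a} b k)

      z-distinct : ∀ k k′ t → z k′ ≋ (λ l → t * z k l) → k ≡ k′
      z-distinct k k′ t eq =
        let i≡i′ , j≡j′ = w-distinct (proj₁ (remQuot {a} b k)) (proj₂ (remQuot {a} b k)) (proj₁ (remQuot {a} b k′)) (proj₂ (remQuot {a} b k′)) t eq
        in ≡.trans (≡.sym (Fin.combine-remQuot {a} b k)) (≡.trans (≡.cong₂ combine i≡i′ j≡j′) (Fin.combine-remQuot {a} b k′))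

    points : PointSet v
    points = record
      { Contains = λ P → ∃[ k ] Member (proj₁ P) (z k)
      ; resp     = λ { (P⊆P′ , _) (k , zk∈P) → k , P⊆P′ zk∈P }
      }

    -- A nonzero vector of a one-dimensional space spans it: z k is s times the representative, and
    -- s is invertible.
    z-multiples : ∀ P k → Member (proj₁ P) (z k) → ∀ {y} → Member (proj₁ P) y → ∃[ t ] y ≋ (λ l → t * z k l)
    z-multiples P k zk∈P {y} y∈P = let
        s , z≋ = representative-spans P zk∈P
        t , y≋ = representative-spans P y∈P
        l , zkl≉0 = z-nonzero k
        s⁻¹ , s⁻¹s≈1 , _ = invertible {s} (λ s≈0 → zkl≉0 (trans (z≋ l) (trans (*-congʳ s≈0) (zeroˡ _))))
      in t * s⁻¹ , λ i → begin
        y i                                 ≈⟨ y≋ i ⟩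
        t * representative P i              ≈⟨ *-congˡ (*-identityˡ _) ⟨
        t * (1# * representative P i)       ≈⟨ *-congˡ (*-congʳ s⁻¹s≈1) ⟨
        t * (s⁻¹ * s * representative P i)  ≈⟨ *-congˡ (*-assoc s⁻¹ s _) ⟩
        t * (s⁻¹ * (s * representative P i)) ≈⟨ *-congˡ (*-congˡ (z≋ i)) ⟨
        t * (s⁻¹ * z k i)                   ≈⟨ *-assoc t s⁻¹ _ ⟨
        t * s⁻¹ * z k i                     ∎
      where open ≈-Reasoning setoid

    points-cardinality : ∣ Contains points ∣≡ (a ℕ.* b)
    points-cardinality = record
      { to        = to
      ; from      = from
      ; to-cong   = λ { {k} ≡.refl → Setoid.refl (pointSetoid v) {proj₁ (to k)} }
      ; from-cong = λ {x} {y} → from-cong {x} {y}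
      ; inverse   = (λ {x} {y} → inverseˡ {x} {y}) , (λ {k} {x} eq → from-cong {x} {to k} eq)
      }
      where
      to : Fin (a ℕ.* b) → Σ (Point v) (Contains points)
      to k = spanPoint (z k) (proj₂ (z-nonzero k)) , k , 1# , λ l → sym (*-identityˡ (z k l))
      -- The index is taken from the membership proof; `from-cong` shows that it depends on the
      -- point alone.
      from : Σ (Point v) (Contains points) → Fin (a ℕ.* b)
      from (_ , k , _) = k
      from-cong : ∀ {x y} → Setoid._≈_ (pointSetoid v) (proj₁ x) (proj₁ y) → from x ≡ from y
      from-cong {P , k , zk∈P} {P′ , k′ , zk′∈P′} (_ , P′⊆P) =
        let t , eq = z-multiples P k zk∈P (P′⊆P zk′∈P′) in z-distinct k k′ t eq
      inverseˡ : ∀ {x k} → k ≡ from x → Setoid._≈_ (pointSetoid v) (proj₁ (to k)) (proj₁ x)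
      inverseˡ {P , k , zk∈P} ≡.refl =
          (λ { (t , y≋) → Subspace.resp (proj₁ P) (λ i → sym (y≋ i)) (Subspace.*-closed (proj₁ P) t zk∈P) })
        , z-multiples P k zk∈P

    points-divisible : ∀ u → (∀ H → IsHyperplane H → (H? : Decidable (Member H)) →
                              (+ (∑[ i < a ] ∑[ j < b ] ⟦ H? (w i j) ⟧)) ≡ u [mod q ]) →
                       IsDivisible q points
    points-divisible u count≡u = u , λ H hyperplane → let H? = member? H (proj₂ (proj₂ hyperplane)) in
        ∑[ k < a ℕ.* b ] ⟦ H? (z k) ⟧
      , ∩-cardinality (pointSetoid v) points-cardinality (λ {P} {P′} → pointsIn-resp H {P} {P′}) (pointsIn? H H?)
      , ≡.subst (λ m → (+ m) ≡ u [mod q ])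
          (≡.sym (≡.trans (sum-combine a (λ k → ⟦ H? (z k) ⟧))
            (sum-cong-≗ λ i → sum-cong-≗ λ j → ≡.cong (λ ij → ⟦ H? (uncurry w ij) ⟧) (Fin.remQuot-combine i j))))
          (count≡u H hyperplane H?)

  divisible-difference : ∀ m u e → m ≡ u ℕ.+ q ℕ.* e → (+ m) ≡ + u [mod q ]
  divisible-difference m u e ≡.refl = ∣⇒∣ᵤ {+ q} {+ m ℤ.- + u} (ℤ.divides (+ e) (≡.trans
      (≡.cong (λ p → + u ℤ.+ p ℤ.- + u) (ℤ.pos-* q e)) (cancel (+ u) (+ q) (+ e))))
    where
    cancel : ∀ u q e → (u ℤ.+ q ℤ.* e) ℤ.- u ≡ e ℤ.* q
    cancel = ℤ.solve-∀

  private
    x+t*0≈x : ∀ {x} t → x + t * 0# ≈ x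
    x+t*0≈x t = trans (+-congˡ (zeroʳ t)) (+-identityʳ _)

    0+t*1≈t : ∀ t → 0# + t * 1# ≈ t
    0+t*1≈t t = trans (+-identityˡ _) (*-identityʳ t)

    1+t*0≉0 : ∀ t → ¬ 1# + t * 0# ≈ 0#
    1+t*0≉0 t ≈0 = 1≉0 (trans (sym (x+t*0≈x t)) ≈0)

    scaled : ∀ {a x y} → a ≈ 1# → y ≈ a * x → x ≈ y
    scaled a≈1 y≈ax = sym (trans y≈ax (trans (*-congʳ a≈1) (*-identityˡ _)))

    to-injective : ∀ {s t} → card.to s ≈ card.to t → s ≡ t
    to-injective {s} {t} eq = ≡.trans (≡.sym (card.strictlyInverseʳ s)) (≡.trans (card.from-cong eq) (card.strictlyInverseʳ t))

    sum-mod : ∀ m (f : Fin m → ℕ) → (∀ i → ∃[ e ] f i ≡ 1 ℕ.+ q ℕ.* e) → ∃[ e ] sum f ≡ m ℕ.+ q ℕ.* e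
    sum-mod m f h = ∑[ i < m ] proj₁ (h i) , (begin
      sum f                                                ≡⟨ sum-cong-≗ (λ i → proj₂ (h i)) ⟩
      ∑[ i < m ] (1 ℕ.+ q ℕ.* proj₁ (h i))                 ≡⟨ ∑-distrib-+ (λ _ → 1) (λ i → q ℕ.* proj₁ (h i)) ⟩
      ∑[ i < m ] 1 ℕ.+ ∑[ i < m ] (q ℕ.* proj₁ (h i))      ≡⟨ ≡.cong₂ ℕ._+_ (≡.trans (sum-const m 1) (ℕ.*-identityʳ m)) (≡.sym (*-distribˡ-sum q (λ i → proj₁ (h i)))) ⟩
      m ℕ.+ q ℕ.* (∑[ i < m ] proj₁ (h i))                 ∎)
      where open ≡.≡-Reasoning

  -- The affine plane: PG(2,q) minus a line.
  affine-plane : ∃[ v ] Σ (PointSet v) λ C → IsDivisible q C × ∣ Contains C ∣≡ (q ℕ.* q)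
  affine-plane = 3 , points , points-divisible (+ 0) count , points-cardinality
    where
    x : Fin q → 𝔽^ 3
    x s = 1# ∷ card.to s ∷ 0# ∷ []
    y : 𝔽^ 3
    y = 0# ∷ 0# ∷ 1# ∷ []
    -- `w s t` is the vector (1 , s , t); each row s becomes a projective line when the common point
    -- y at infinity is added.
    w : Fin q → Fin q → 𝔽^ 3
    w s t i = x s i + card.to t * y i
    distinct : ∀ s t s′ t′ a → w s′ t′ ≋ (λ i → a * w s t i) → s ≡ s′ × t ≡ t′
    distinct s t s′ t′ a eq =
        to-injective (scaled a≈1 (trans (sym (x+t*0≈x (card.to t′))) (trans (eq (suc zero)) (*-congˡ (x+t*0≈x (card.to t))))))
      , to-injective (scaled a≈1 (trans (sym (0+t*1≈t (card.to t′))) (trans (eq (suc (suc zero))) (*-congˡ (0+t*1≈t (card.to t))))))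
      where
      a≈1 : a ≈ 1#
      a≈1 = sym (trans (sym (x+t*0≈x (card.to t′))) (trans (eq zero) (trans (*-congˡ (x+t*0≈x (card.to t))) (*-identityʳ a))))
    open Family w (λ s t → zero , 1+t*0≉0 (card.to t)) distinct
    count : ∀ H → IsHyperplane H → (H? : Decidable (Member H)) → (+ (∑[ s < q ] ∑[ t < q ] ⟦ H? (w s t) ⟧)) ≡ + 0 [mod q ]
    count H hyperplane H? = ≡.subst (q ℕ.∣_) (≡.cong ℤ.∣_∣ (≡.sym (ℤ.+-identityʳ (+ S)))) (ℕ.∣m+n∣m⇒∣n {n = S} q∣total (ℕ.m∣m*n ⟦ H? y ⟧))
      where
      S = ∑[ s < q ] ∑[ t < q ] ⟦ H? (w s t) ⟧
      -- Adding y to each of the q rows completes them to lines, each counted 1 modulo q. The total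
      -- is 0 modulo q, and so is the contribution of the q copies of y.
      lines = sum-mod q (λ s → ∑[ t < q ] ⟦ H? (w s t) ⟧ ℕ.+ ⟦ H? y ⟧) (λ s → line-count H hyperplane H? (x s) y)
      q∣total : q ℕ.∣ q ℕ.* ⟦ H? y ⟧ ℕ.+ S
      q∣total = divides (suc (proj₁ lines)) (begin
        q ℕ.* ⟦ H? y ⟧ ℕ.+ S                                  ≡⟨ ℕ.+-comm (q ℕ.* ⟦ H? y ⟧) S ⟩
        S ℕ.+ q ℕ.* ⟦ H? y ⟧                                  ≡⟨ ≡.cong (S ℕ.+_) (sum-const q ⟦ H? y ⟧) ⟨
        S ℕ.+ ∑[ s < q ] ⟦ H? y ⟧                             ≡⟨ ∑-distrib-+ (λ s → ∑[ t < q ] ⟦ H? (w s t) ⟧) (λ _ → ⟦ H? y ⟧) ⟨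
        ∑[ s < q ] (∑[ t < q ] ⟦ H? (w s t) ⟧ ℕ.+ ⟦ H? y ⟧)   ≡⟨ proj₂ lines ⟩
        q ℕ.+ q ℕ.* proj₁ lines                               ≡⟨ ℕ.*-suc q (proj₁ lines) ⟨
        q ℕ.* suc (proj₁ lines)                               ≡⟨ ℕ.*-comm q _ ⟩
        suc (proj₁ lines) ℕ.* q                               ∎)
        where open ≡.≡-Reasoning

  -- Pairwise disjoint lines {(x , y , λ x , λ y)} of PG(3,q), one for each of m values λ ∈ F.
  partial-spread : ∀ m → m ℕ.≤ q → ∃[ v ] Σ (PointSet v) λ C → IsDivisible q C × ∣ Contains C ∣≡ (m ℕ.* suc q)
  partial-spread m m≤q = 4 , points , points-divisible (+ m) count , points-cardinality
    where
    slope : Fin m → Carrier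
    slope i = card.to (inject≤ i m≤q)
    x y : Fin m → 𝔽^ 4
    x i = 1# ∷ 0# ∷ slope i ∷ 0# ∷ []
    y i = 0# ∷ 1# ∷ 0# ∷ slope i ∷ []
    -- Row i lists all q + 1 points of its line: y i, then x i + t y i for t in F.
    w : Fin m → Fin (suc q) → 𝔽^ 4
    w i zero    = y i
    w i (suc t) = λ l → x i l + card.to t * y i l
    slope-injective : ∀ {i j} → slope i ≈ slope j → i ≡ j
    slope-injective eq = Fin.inject≤-injective m≤q m≤q _ _ (to-injective eq)
    nonzero-w : ∀ i j → ∃[ l ] ¬ w i j l ≈ 0#
    nonzero-w i zero    = suc zero , 1≉0
    nonzero-w i (suc t) = zero , 1+t*0≉0 (card.to t)
    distinct : ∀ i j i′ j′ a → w i′ j′ ≋ (λ l → a * w i j l) → i ≡ i′ × j ≡ j′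
    -- Coordinates 0 and 1, equal to (0 , 1) or (1 , t), give the position on the line. They force a
    -- = 1 or a contradiction; coordinate 2 or 3 then gives the slope.
    distinct i zero i′ zero a eq = slope-injective (scaled a≈1 (eq (suc (suc (suc zero))))) , ≡.refl
      where
      a≈1 : a ≈ 1#
      a≈1 = sym (trans (eq (suc zero)) (*-identityʳ a))
    distinct i zero i′ (suc t′) a eq = contradiction (trans (eq zero) (zeroʳ a)) (1+t*0≉0 (card.to t′))
    distinct i (suc t) i′ zero a eq = contradiction (trans (eq (suc zero)) (trans (*-congʳ a≈0) (zeroˡ _))) 1≉0
      where
      a≈0 : a ≈ 0#
      a≈0 = sym (trans (eq zero) (trans (*-congˡ (x+t*0≈x (card.to t))) (*-identityʳ a)))
    distinct i (suc t) i′ (suc t′) a eq =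
        slope-injective (scaled a≈1 (trans (sym (x+t*0≈x (card.to t′))) (trans (eq (suc (suc zero))) (*-congˡ (x+t*0≈x (card.to t))))))
      , ≡.cong suc (to-injective (scaled a≈1 (trans (sym (0+t*1≈t (card.to t′))) (trans (eq (suc zero)) (*-congˡ (0+t*1≈t (card.to t)))))))
      where
      a≈1 : a ≈ 1#
      a≈1 = sym (trans (sym (x+t*0≈x (card.to t′))) (trans (eq zero) (trans (*-congˡ (x+t*0≈x (card.to t))) (*-identityʳ a))))
    open Family w nonzero-w distinct
    count : ∀ H → IsHyperplane H → (H? : Decidable (Member H)) → (+ (∑[ i < m ] ∑[ j < suc q ] ⟦ H? (w i j) ⟧)) ≡ + m [mod q ]
    count H hyperplane H? = let e , total = sum-mod m (λ i → ∑[ j < suc q ] ⟦ H? (w i j) ⟧) line in divisible-difference _ m e total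
      where
      -- Every row is a complete line and counts 1 modulo q, whence the residue m.
      line : ∀ i → ∃[ e ] ∑[ j < suc q ] ⟦ H? (w i j) ⟧ ≡ 1 ℕ.+ q ℕ.* e
      line i = let e , eq = line-count H hyperplane H? (x i) (y i) in e , ≡.trans (ℕ.+-comm ⟦ H? (y i) ⟧ _) eq

  cardinality⇒divisible : ∀ (n : ℕ) → n ℕ.≤ q ℕ.^ 2 → n ≡ q ℕ.^ 2 ⊎ (q ℕ.+ 1) ℕ.∣ n →
    ∃[ v ] Σ (PointSet v) λ C → IsDivisible q C × ∣ Contains C ∣≡ n
  cardinality⇒divisible n n≤q² (inj₁ ≡.refl) =
    ≡.subst (λ n → ∃[ v ] Σ (PointSet v) λ C → IsDivisible q C × ∣ Contains C ∣≡ n) (≡.cong (q ℕ.*_) (≡.sym (ℕ.*-identityʳ q))) affine-plane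
  cardinality⇒divisible n n≤q² (inj₂ (divides m ≡.refl)) =
    ≡.subst (λ k → ∃[ v ] Σ (PointSet v) λ C → IsDivisible q C × ∣ Contains C ∣≡ (m ℕ.* k)) (ℕ.+-comm 1 q) (partial-spread m m≤q)
    where
    -- From m (q + 1) ≤ q² it follows that F has enough elements for m distinct slopes.
    m≤q : m ℕ.≤ q
    m≤q = ℕ.*-cancelʳ-≤ m q q (begin
      m ℕ.* q         ≤⟨ ℕ.*-monoʳ-≤ m (ℕ.m≤m+n q 1) ⟩
      m ℕ.* (q ℕ.+ 1) ≤⟨ n≤q² ⟩
      q ℕ.^ 2         ≡⟨ ≡.cong (q ℕ.*_) (ℕ.*-identityʳ q) ⟩
      q ℕ.* q         ∎)
      where open ℕ.≤-Reasoning

open import Data.Nat.Base using (ℕ; _+_; _^_; _≤_)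
open import Data.Nat.Divisibility using (_∣_)
open import Data.Product.Base using (_×_; Σ-syntax; ∃-syntax)
open import Data.Sum.Base using (_⊎_)
open import Relation.Binary.PropositionalEquality.Core using (_≡_)

theorem5p15 : ∀ {c ℓ} (q : ℕ) → IsPrimePower q →
    (F : Field c ℓ) → HasCardinality (Field.setoid F) q →
    let open ProjectiveSpace F in
    (∀ (v : ℕ) (C : PointSet v) → IsDivisible q C →
    ∀ (n : ℕ) → ∣ Contains C ∣≡ n → 2 ≤ n → n ≤ q ^ 2 →
    n ≡ q ^ 2 ⊎ (q + 1) ∣ n)
    ×
    (∀ (n : ℕ) → 2 ≤ n → n ≤ q ^ 2 → n ≡ q ^ 2 ⊎ (q + 1) ∣ n →
    ∃[ v ] Σ[ C ∈ PointSet v ] (IsDivisible q C × ∣ Contains C ∣≡ n))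
-- A field has a zero element, so q = suc r, where r counts the nonzero elements.
theorem5p15 zero    _ F card with () ← Inverse.from card (Field.0# F)
theorem5p15 (suc r) _ F card = divisible⇒cardinality , λ n _ → cardinality⇒divisible n
  where open FiniteField F card
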